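{- Let $m$ be a fixed positive integer, $p=\frac12$ and $\varepsilon>0$. If $l=l(n)$ is a sequence of integers with $l\ge (4+\varepsilon)\log_2 n$, then asymptotically almost surely $\tilde H_{l-m+1}(N_m(G(n,p)))=0$.
   Context: $G(n,p)$ is the Erdős–Rényi random graph on $n$ vertices in which each edge appears independently with probability $p$. For a graph $G$ and a nonnegative integer $m$, the multineighbor complex $N_m(G)$ is the simplicial complex in which a set of $q+1$ vertices of $G$ ($q\ge 0$) is a $q$-simplex if and only if these vertices have at least $m$ common neighbors in $G$. $\tilde H_*$ denotes reduced simplicial homology with integer coefficients. A property holds asymptotically almost surely (a.a.s.) if its probability tends to $1$ as $n\to\infty$. -}

module Defs where

open import Algebra.Bundles using (AbelianGroup)
import Algebra.Properties.CommutativeMonoid.Sum as Sum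
open import Data.Bool.Base using (Bool; true; false; T; if_then_else_)
open import Data.Fin.Base using (Fin; zero; suc)
open import Data.Fin.Subset using (Subset; _∈_; _⊆_; ∣_∣; Nonempty; _∪_; ⁅_⁆) renaming (⊥ to ∅)
open import Data.Fin.Subset.Properties using (_∈?_; ∉⊥)
open import Data.Integer.Base as ℤ using (ℤ; +_; -[1+_]; 0ℤ; -1ℤ)
import Data.Integer.Properties as ℤ
open import Data.Integer.Tactic.RingSolver using (solve-∀)
open import Data.Nat.Base as ℕ using (ℕ; zero; suc)
open import Data.Product.Base using (∃; ∃-syntax; _×_; _,_; proj₁; proj₂)
open import Data.Rational.Base as ℚ using (ℚ; 0ℚ; 1ℚ; ↥_; ↧_)
import Data.Rational.Properties as ℚ
open import Data.Sum.Base using (_⊎_; inj₁; inj₂; [_,_]′)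
open import Data.Vec.Base using (Vec; []; _∷_; lookup)
open import Function.Base using (_∘_)
open import Level using (0ℓ)
open import Relation.Binary.PropositionalEquality
open import Relation.Nullary using (¬_; does; yes; no; contradiction)

open Sum ℤ.+-0-commutativeMonoid using (sum; sum-cong-≗; ∑-distrib-+; sum-replicate-zero)

------------------------------------------------------------------------
-- Real numbers and binary logarithms

-- Two-sided Dedekind cuts of ℚ.
record ℝ : Set₁ where
  field
    Lower Upper     : ℚ → Set
    lower-inhabited : ∃ Lower
    upper-inhabited : ∃ Upper
    lower-closed    : ∀ {q r} → q ℚ.< r → Lower r → Lower q
    upper-closed    : ∀ {q r} → q ℚ.< r → Upper q → Upper r
    lower-open      : ∀ {q} → Lower q → ∃[ r ] q ℚ.< r × Lower r
    upper-open      : ∀ {r} → Upper r → ∃[ q ] q ℚ.< r × Upper q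
    separated       : ∀ {q r} → Lower q → Upper r → q ℚ.< r
    located         : ∀ {q r} → q ℚ.< r → Lower q ⊎ Upper r

open ℝ public

Positive : ℝ → Set
Positive x = Lower x 0ℚ

private
  shift-cancel : ∀ a q → (a ℚ.+ q) ℚ.- a ≡ q
  shift-cancel a q = begin
    (a ℚ.+ q) ℚ.- a    ≡⟨ cong (ℚ._- a) (ℚ.+-comm a q) ⟩
    (q ℚ.+ a) ℚ.- a    ≡⟨ ℚ.+-assoc q a (ℚ.- a) ⟩
    q ℚ.+ (a ℚ.- a)    ≡⟨ cong (q ℚ.+_) (ℚ.+-inverseʳ a) ⟩
    q ℚ.+ 0ℚ           ≡⟨ ℚ.+-identityʳ q ⟩
    q                  ∎
    where open ≡-Reasoning

  shift-cancel′ : ∀ a q → a ℚ.+ (q ℚ.- a) ≡ q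
  shift-cancel′ a q = trans (sym (ℚ.+-assoc a q (ℚ.- a))) (shift-cancel a q)

  shift-< : ∀ a {q r} → q ℚ.< r → q ℚ.- a ℚ.< r ℚ.- a
  shift-< a = ℚ.+-monoˡ-< (ℚ.- a)

  unshift-< : ∀ a {q r} → q ℚ.- a ℚ.< r ℚ.- a → q ℚ.< r
  unshift-< a {q} {r} lt =
    subst₂ ℚ._<_ (shift-cancel′ a q) (shift-cancel′ a r) (ℚ.+-monoʳ-< a lt)

  above : ∀ a {q r} → q ℚ.- a ℚ.< r → q ℚ.< a ℚ.+ r
  above a {q} {r} lt = unshift-< a (subst (_ ℚ.<_) (sym (shift-cancel a r)) lt)

  below′ : ∀ a {q r} → q ℚ.< r ℚ.- a → a ℚ.+ q ℚ.< r
  below′ a {q} {r} lt = unshift-< a (subst (ℚ._< _) (sym (shift-cancel a q)) lt)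

infixl 6 _+ᴿ_

_+ᴿ_ : ℚ → ℝ → ℝ
a +ᴿ x = record
  { Lower           = λ q → Lower x (q ℚ.- a)
  ; Upper           = λ q → Upper x (q ℚ.- a)
  ; lower-inhabited = let q , q∈ = lower-inhabited x in
                      a ℚ.+ q , subst (Lower x) (sym (shift-cancel a q)) q∈
  ; upper-inhabited = let q , q∈ = upper-inhabited x in
                      a ℚ.+ q , subst (Upper x) (sym (shift-cancel a q)) q∈
  ; lower-closed    = lower-closed x ∘ shift-< a
  ; upper-closed    = upper-closed x ∘ shift-< a
  ; lower-open      = λ q∈ → let r , q<r , r∈ = lower-open x q∈ in
                      a ℚ.+ r , above a q<r , subst (Lower x) (sym (shift-cancel a r)) r∈
  ; upper-open      = λ r∈ → let q , q<r , q∈ = upper-open x r∈ in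
                      a ℚ.+ q , below′ a q<r , subst (Upper x) (sym (shift-cancel a q)) q∈
  ; separated       = λ q∈ r∈ → unshift-< a (separated x q∈ r∈)
  ; located         = located x ∘ shift-< a
  }

-- Positive and negative parts: i = i ⁺ - i ⁻.
_⁺ _⁻ : ℤ → ℕ
(+ k)    ⁺ = k
-[1+ k ] ⁺ = 0
i ⁻ = (ℤ.- i) ⁺

-- For n ≥ 1, a · log₂ n ≤ c says nᵃ ≤ 2ᶜ; negative powers are moved to the
-- other side so that all exponents are natural numbers.
_·log₂_≤ᶻ_ : ℤ → ℕ → ℤ → Set
a ·log₂ n ≤ᶻ c = n ℕ.^ (a ⁺) ℕ.* 2 ℕ.^ (c ⁻) ℕ.≤ 2 ℕ.^ (c ⁺) ℕ.* n ℕ.^ (a ⁻)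

-- For n ≥ 1 (so that log₂ n ≥ 0), x · log₂ n ≤ c holds for a real x iff
-- q · log₂ n ≤ c for every rational q < x; denominators are cleared.
_·log₂_≤_ : ℝ → ℕ → ℤ → Set
x ·log₂ n ≤ c = ∀ q → Lower x q → (↥ q) ·log₂ n ≤ᶻ ((↧ q) ℤ.* c)

------------------------------------------------------------------------
-- Simplicial complexes and reduced integral homology

-- Vertices lie in Fin n, not every element of which need be a vertex. The
-- empty set is a face (of dimension -1).
record SimplicialComplex (n : ℕ) : Set₁ where
  field
    Face      : Subset n → Set
    ∅-face    : Face ∅
    face-down : ∀ {σ τ} → σ ⊆ τ → Face τ → Face σ

open SimplicialComplex public

-- The number of elements of σ smaller than v.
rank : ∀ {n} → Fin n → Subset n → ℕ
rank zero    σ           = 0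
rank (suc v) (true  ∷ σ) = suc (rank v σ)
rank (suc v) (false ∷ σ) = rank v σ

-- Simplices are oriented by the order of Fin n, so that
-- ∂[v₀,…,v_k] = Σᵢ (-1)ⁱ [v₀,…,v̂ᵢ,…,v_k]. The coefficient of τ in ∂ c thus
-- collects the coefficients of the sets σ = τ ∪ {v} with v ∉ τ, with sign
-- (-1)ⁱ where i is the position of v in σ. For τ = ∅ this is the augmentation.
∂-term : ∀ {n} → (Subset n → ℤ) → Subset n → Fin n → ℤ
∂-term c τ v = if does (v ∈? τ) then 0ℤ else (-1ℤ ℤ.^ rank v τ) ℤ.* c (τ ∪ ⁅ v ⁆)

∂ : ∀ {n} → (Subset n → ℤ) → (Subset n → ℤ)
∂ c τ = sum (∂-term c τ)

-- Degree q chains of the augmented chain complex: integer combinations of the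
-- faces of dimension q, for any integer q. The empty face spans degree -1.
record Chain {n} (K : SimplicialComplex n) (q : ℤ) : Set where
  field
    coeff   : Subset n → ℤ
    support : ∀ σ → coeff σ ≢ 0ℤ → Face K σ × + ∣ σ ∣ ≡ ℤ.suc q

open Chain public

record Cycle {n} (K : SimplicialComplex n) (q : ℤ) : Set where
  field
    chain  : Chain K q
    closed : ∀ τ → ∂ (coeff chain) τ ≡ 0ℤ

open Cycle public

private
  ∂-cong : ∀ {n} {c d : Subset n → ℤ} → (∀ σ → c σ ≡ d σ) → ∀ τ → ∂ c τ ≡ ∂ d τ
  ∂-cong c≗d τ = sum-cong-≗ λ v →
    cong (λ x → if does (v ∈? τ) then 0ℤ else (-1ℤ ℤ.^ rank v τ) ℤ.* x) (c≗d (τ ∪ ⁅ v ⁆))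

  ∂-0 : ∀ {n} (τ : Subset n) → ∂ (λ _ → 0ℤ) τ ≡ 0ℤ
  ∂-0 {n} τ = trans (sum-cong-≗ term) (sum-replicate-zero n)
    where
    term : ∀ v → ∂-term (λ _ → 0ℤ) τ v ≡ 0ℤ
    term v with does (v ∈? τ)
    ... | true  = refl
    ... | false = ℤ.*-zeroʳ (-1ℤ ℤ.^ rank v τ)

  ∂-+ : ∀ {n} (c d : Subset n → ℤ) τ → ∂ (λ σ → c σ ℤ.+ d σ) τ ≡ ∂ c τ ℤ.+ ∂ d τ
  ∂-+ c d τ = trans (sum-cong-≗ term) (∑-distrib-+ (∂-term c τ) (∂-term d τ))
    where
    term : ∀ v → ∂-term (λ σ → c σ ℤ.+ d σ) τ v ≡ ∂-term c τ v ℤ.+ ∂-term d τ v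
    term v with does (v ∈? τ)
    ... | true  = refl
    ... | false = ℤ.*-distribˡ-+ (-1ℤ ℤ.^ rank v τ) _ _

  ∂-neg : ∀ {n} (c : Subset n → ℤ) τ → ∂ (λ σ → ℤ.- c σ) τ ≡ ℤ.- ∂ c τ
  ∂-neg c τ = begin
    x                          ≡⟨ lemma x y ⟩
    (x ℤ.+ y) ℤ.+ (ℤ.- y)      ≡⟨ cong (ℤ._+ (ℤ.- y)) x+y≡0 ⟩
    0ℤ ℤ.+ (ℤ.- y)             ≡⟨ ℤ.+-identityˡ _ ⟩
    ℤ.- y                      ∎
    where
    open ≡-Reasoning
    x = ∂ (λ σ → ℤ.- c σ) τ
    y = ∂ c τ
    lemma : ∀ i j → i ≡ (i ℤ.+ j) ℤ.+ (ℤ.- j)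
    lemma = solve-∀
    x+y≡0 : x ℤ.+ y ≡ 0ℤ
    x+y≡0 = trans (sym (∂-+ (λ σ → ℤ.- c σ) c τ))
                  (trans (∂-cong (λ σ → ℤ.+-inverseˡ (c σ)) τ) (∂-0 τ))

module _ {n} {K : SimplicialComplex n} {q : ℤ} where

  0ᶜ : Chain K q
  0ᶜ = record { coeff = λ _ → 0ℤ ; support = λ _ 0≢0 → contradiction refl 0≢0 }

  _+ᶜ_ : Chain K q → Chain K q → Chain K q
  c +ᶜ d = record { coeff = λ σ → coeff c σ ℤ.+ coeff d σ ; support = supp }
    where
    supp : ∀ σ → coeff c σ ℤ.+ coeff d σ ≢ 0ℤ → Face K σ × + ∣ σ ∣ ≡ ℤ.suc q
    supp σ c+d≢0 with coeff c σ ℤ.≟ 0ℤ | coeff d σ ℤ.≟ 0ℤ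
    ... | no c≢0  | _       = support c σ c≢0
    ... | yes _   | no d≢0  = support d σ d≢0
    ... | yes c≡0 | yes d≡0 = contradiction (cong₂ ℤ._+_ c≡0 d≡0) c+d≢0

  -ᶜ_ : Chain K q → Chain K q
  -ᶜ c = record
    { coeff   = λ σ → ℤ.- coeff c σ
    ; support = λ σ -c≢0 → support c σ (-c≢0 ∘ cong (ℤ.-_))
    }

  0ᶻ : Cycle K q
  0ᶻ = record { chain = 0ᶜ ; closed = ∂-0 }

  _+ᶻ_ : Cycle K q → Cycle K q → Cycle K q
  z +ᶻ w = record
    { chain  = chain z +ᶜ chain w
    ; closed = λ τ → trans (∂-+ (coeff (chain z)) (coeff (chain w)) τ)
                           (cong₂ ℤ._+_ (closed z τ) (closed w τ))
    }

  -ᶻ_ : Cycle K q → Cycle K q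
  -ᶻ z = record
    { chain  = -ᶜ chain z
    ; closed = λ τ → trans (∂-neg (coeff (chain z)) τ) (cong (ℤ.-_) (closed z τ))
    }

-- Two q-cycles are homologous when their difference is the boundary of a
-- (q+1)-chain.
Homologous : ∀ {n} {K : SimplicialComplex n} {q} → Cycle K q → Cycle K q → Set
Homologous {K = K} {q} z w = ∃[ b ] (∀ σ →
  coeff (chain z) σ ℤ.- coeff (chain w) σ ≡ ∂ (coeff {K = K} {q = ℤ.suc q} b) σ)

module _ {n} {K : SimplicialComplex n} {q : ℤ} where

  private
    infix 4 _≈_
    _≈_ : Cycle K q → Cycle K q → Set
    _≈_ = Homologous

    ⟦_⟧ : Cycle K q → Subset n → ℤ
    ⟦ z ⟧ = coeff (chain z)

    ≗⇒≈ : ∀ {z w} → (∀ σ → ⟦ z ⟧ σ ≡ ⟦ w ⟧ σ) → z ≈ w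
    ≗⇒≈ {z} z≗w = 0ᶜ , λ σ →
      trans (cong (λ x → ⟦ z ⟧ σ ℤ.- x) (sym (z≗w σ)))
            (trans (ℤ.+-inverseʳ (⟦ z ⟧ σ)) (sym (∂-0 σ)))

    ≈-sym : ∀ {z w} → z ≈ w → w ≈ z
    ≈-sym {z} {w} (b , eq) = -ᶜ b , λ σ →
      trans (lemma (⟦ z ⟧ σ) (⟦ w ⟧ σ))
            (trans (cong (ℤ.-_) (eq σ)) (sym (∂-neg (coeff b) σ)))
      where
      lemma : ∀ i j → j ℤ.- i ≡ ℤ.- (i ℤ.- j)
      lemma = solve-∀

    ≈-trans : ∀ {z w u} → z ≈ w → w ≈ u → z ≈ u
    ≈-trans {z} {w} {u} (b , eq) (b′ , eq′) = b +ᶜ b′ , λ σ →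
      trans (lemma (⟦ z ⟧ σ) (⟦ w ⟧ σ) (⟦ u ⟧ σ))
            (trans (cong₂ ℤ._+_ (eq σ) (eq′ σ)) (sym (∂-+ (coeff b) (coeff b′) σ)))
      where
      lemma : ∀ i j k → i ℤ.- k ≡ (i ℤ.- j) ℤ.+ (j ℤ.- k)
      lemma = solve-∀

    +ᶻ-cong : ∀ {z w u v} → z ≈ w → u ≈ v → (z +ᶻ u) ≈ (w +ᶻ v)
    +ᶻ-cong {z} {w} {u} {v} (b , eq) (b′ , eq′) = b +ᶜ b′ , λ σ →
      trans (lemma (⟦ z ⟧ σ) (⟦ w ⟧ σ) (⟦ u ⟧ σ) (⟦ v ⟧ σ))
            (trans (cong₂ ℤ._+_ (eq σ) (eq′ σ)) (sym (∂-+ (coeff b) (coeff b′) σ)))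
      where
      lemma : ∀ i j k l → (i ℤ.+ k) ℤ.- (j ℤ.+ l) ≡ (i ℤ.- j) ℤ.+ (k ℤ.- l)
      lemma = solve-∀

    -ᶻ-cong : ∀ {z w} → z ≈ w → (-ᶻ z) ≈ (-ᶻ w)
    -ᶻ-cong {z} {w} (b , eq) = -ᶜ b , λ σ →
      trans (lemma (⟦ z ⟧ σ) (⟦ w ⟧ σ))
            (trans (cong (ℤ.-_) (eq σ)) (sym (∂-neg (coeff b) σ)))
      where
      lemma : ∀ i j → (ℤ.- i) ℤ.- (ℤ.- j) ≡ ℤ.- (i ℤ.- j)
      lemma = solve-∀

  homology : AbelianGroup 0ℓ 0ℓ
  homology = record
    { Carrier = Cycle K q
    ; _≈_     = _≈_
    ; _∙_     = _+ᶻ_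
    ; ε       = 0ᶻ
    ; _⁻¹     = -ᶻ_
    ; isAbelianGroup = record
      { isGroup = record
        { isMonoid = record
          { isSemigroup = record
            { isMagma = record
              { isEquivalence = record
                { refl  = λ {z} → ≗⇒≈ {z} {z} λ _ → refl
                ; sym   = λ {z} {w} → ≈-sym {z} {w}
                ; trans = λ {z} {w} {u} → ≈-trans {z} {w} {u}
                }
              ; ∙-cong = λ {z} {w} {u} {v} → +ᶻ-cong {z} {w} {u} {v}
              }
            ; assoc = λ z w u → ≗⇒≈ {(z +ᶻ w) +ᶻ u} {z +ᶻ (w +ᶻ u)} λ σ →
                ℤ.+-assoc (⟦ z ⟧ σ) (⟦ w ⟧ σ) (⟦ u ⟧ σ)
            }
          ; identity = (λ z → ≗⇒≈ {0ᶻ +ᶻ z} {z} λ σ → ℤ.+-identityˡ (⟦ z ⟧ σ))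
                     , (λ z → ≗⇒≈ {z +ᶻ 0ᶻ} {z} λ σ → ℤ.+-identityʳ (⟦ z ⟧ σ))
          }
        ; inverse = (λ z → ≗⇒≈ {(-ᶻ z) +ᶻ z} {0ᶻ} λ σ → ℤ.+-inverseˡ (⟦ z ⟧ σ))
                  , (λ z → ≗⇒≈ {z +ᶻ (-ᶻ z)} {0ᶻ} λ σ → ℤ.+-inverseʳ (⟦ z ⟧ σ))
        ; ⁻¹-cong = λ {z} {w} → -ᶻ-cong {z} {w}
        }
      ; comm = λ z w → ≗⇒≈ {z +ᶻ w} {w +ᶻ z} λ σ → ℤ.+-comm (⟦ z ⟧ σ) (⟦ w ⟧ σ)
      }
    }

H̃ : ∀ {n} → ℤ → SimplicialComplex n → AbelianGroup 0ℓ 0ℓ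
H̃ q K = homology {K = K} {q = q}

IsTrivial : AbelianGroup 0ℓ 0ℓ → Set
IsTrivial A = ∀ x → x ≈ ε
  where open AbelianGroup A

------------------------------------------------------------------------
-- Graphs and multineighbor complexes

record Graph (n : ℕ) : Set where
  field
    adjacent  : Fin n → Fin n → Bool
    symmetric : ∀ u v → adjacent u v ≡ adjacent v u
    loopless  : ∀ v → adjacent v v ≡ false

open Graph public

CommonNeighbors : ∀ {n} → Graph n → Subset n → Subset n → Set
CommonNeighbors G σ ν = ∀ {u v} → u ∈ σ → v ∈ ν → T (adjacent G u v)

-- The premise Nonempty σ makes the empty set a face even when n < m.
multineighborComplex : ∀ {n} → ℕ → Graph n → SimplicialComplex n
multineighborComplex m G = record
  { Face      = λ σ → Nonempty σ → ∃[ ν ] CommonNeighbors G σ ν × m ℕ.≤ ∣ ν ∣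
  ; ∅-face    = λ { (_ , v∈∅) → contradiction v∈∅ ∉⊥ }
  ; face-down = λ { σ⊆τ face (v , v∈σ) →
      let ν , common , m≤ = face (v , σ⊆τ v∈σ) in
      ν , (λ u∈σ → common (σ⊆τ u∈σ)) , m≤ }
  }

------------------------------------------------------------------------
-- The random graph G(n,p)

-- An outcome is one bit per pair of distinct vertices: the first row holds the
-- pairs {0, v}, the remaining rows the pairs avoiding 0.
data Outcome : ℕ → Set where
  []  : Outcome 0
  _∷_ : ∀ {n} → Vec Bool n → Outcome n → Outcome (suc n)

edge : ∀ {n} → Outcome n → Fin n → Fin n → Bool
edge (e ∷ ω) zero    zero    = false
edge (e ∷ ω) zero    (suc v) = lookup e v
edge (e ∷ ω) (suc u) zero    = lookup e u
edge (e ∷ ω) (suc u) (suc v) = edge ω u v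

graph : ∀ {n} → Outcome n → Graph n
graph ω = record { adjacent = edge ω ; symmetric = edge-sym ω ; loopless = edge-irrefl ω }
  where
  edge-sym : ∀ {n} (ω : Outcome n) u v → edge ω u v ≡ edge ω v u
  edge-sym (e ∷ ω) zero    zero    = refl
  edge-sym (e ∷ ω) zero    (suc v) = refl
  edge-sym (e ∷ ω) (suc u) zero    = refl
  edge-sym (e ∷ ω) (suc u) (suc v) = edge-sym ω u v

  edge-irrefl : ∀ {n} (ω : Outcome n) v → edge ω v v ≡ false
  edge-irrefl (e ∷ ω) zero    = refl
  edge-irrefl (e ∷ ω) (suc v) = edge-irrefl ω v

-- Expectations when the bits are independent and each is true with
-- probability p, computed as iterated sums.
𝔼-bit : ℚ → (Bool → ℚ) → ℚ
𝔼-bit p f = p ℚ.* f true ℚ.+ (1ℚ ℚ.- p) ℚ.* f false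

𝔼-row : ∀ {n} → ℚ → (Vec Bool n → ℚ) → ℚ
𝔼-row {zero}  p f = f []
𝔼-row {suc n} p f = 𝔼-bit p λ b → 𝔼-row p λ e → f (b ∷ e)

𝔼 : ∀ {n} → ℚ → (Outcome n → ℚ) → ℚ
𝔼 {zero}  p f = f []
𝔼 {suc n} p f = 𝔼-row p λ e → 𝔼 p λ ω → f (e ∷ ω)

Pr : ∀ {n} → ℚ → (Outcome n → Bool) → ℚ
Pr p B = 𝔼 p λ ω → if B ω then 1ℚ else 0ℚ

-- The probability that G(n,p) satisfies A exceeds r. As A need not come with a
-- decision procedure, this is witnessed by a decidable event B contained in A;
-- for decidable A one can take B = A.
Pr[G⟨n,_⟩∈_]>_ : ∀ {n} → ℚ → (Graph n → Set) → ℚ → Set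
Pr[G⟨n, p ⟩∈ A ]> r = ∃[ B ] (∀ ω → T (B ω) → A (graph ω)) × r ℚ.< Pr p B

-- The probability that G(n,p) satisfies A n tends to 1 (it is at most 1).
AAS : ℚ → (∀ {n} → Graph n → Set) → Set
AAS p A = ∀ δ → 0ℚ ℚ.< δ → ∃[ N ] (∀ n → N ℕ.≤ n → Pr[G⟨n, p ⟩∈ A {n} ]> (1ℚ ℚ.- δ))

module Submission where

-- Let CN σ be the set of common neighbours of σ, and let x(σ) be a vertex
-- adjacent to all of CN σ that depends on CN σ only. Coning with apex x(σ)
-- gives an acyclic-carrier argument: h[σ] = x(σ) * ([σ] - h ∂[σ]) is a
-- homotopy from the identity to a chain map φ with φ[σ] = x(σ) * φ ∂[σ], and
-- h[σ] is supported on sets whose common neighbours include CN σ. Since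
-- x * x * c = 0, a flag of faces of σ contributes to φ[σ] only if CN grows
-- strictly each time a vertex is removed. So if |σ| + m = i + i′ and no i
-- vertices have i′ common neighbours, then φ[σ] = 0 and every cycle z is ∂ h z.
-- For the degree at hand i + i′ = l + 2; with i and i′ as equal as possible, a
-- union bound over the at most n^(l+2) pairs of vertex sets gives probability at
-- most n^(l+2) 2^(-i i′) for a biclique K_{i,i′}, and this tends to 0 because
-- n⁴ ≤ 2^l.

open import Algebra.Bundles using (CommutativeRing)
open import Data.Bool.Base using (Bool; true; false; T; if_then_else_; _∧_; _∨_; not)
open import Data.Fin.Base using (Fin; zero; suc)
open import Data.Fin.Subset using (Subset; _∈_; _⊆_; ∣_∣; Nonempty)
import Data.Integer.Base as ℤ
import Data.Integer.Properties as ℤ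
open import Data.Nat.Base as ℕ using (ℕ; zero; suc; NonZero; z≤n; s≤s)
import Data.Nat.Properties as ℕ
open import Data.Product.Base using (∃; ∃-syntax; _×_; _,_)
import Data.Rational.Base as ℚ
import Data.Rational.Properties as ℚ
import Data.Sum.Base as Sum
open import Data.Sum.Base using (_⊎_; inj₁; inj₂)
open import Data.Vec.Base as Vec using (Vec; []; _∷_; lookup; tabulate)
open import Function.Base using (_∘_; id)
open import Relation.Binary.PropositionalEquality
open import Relation.Nullary using (¬_; Dec; does; yes; no; contradiction)
open import Defs

private
  variable
    k n : ℕ

-- Simplicial chains: boundary, cones and the acyclicity argument.

module Acyclicity where

  open import Algebra.Properties.CommutativeMonoid.Sum ℤ.+-0-commutativeMonoid
    using (sum; sum-cong-≗)
  open import Data.Fin.Properties using (all?; any?)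
  open import Data.Fin.Subset.Properties
    using (_∈?_; ∪-identityʳ; drop-∷-⊆; s⊆s; out⊆; p⊆q⇒∣p∣≤∣q∣)
  open import Data.Integer.Base using (ℤ; +_; _+_; _*_; _-_; -_; 0ℤ; 1ℤ; -1ℤ; _^_)
  open import Data.Integer.Tactic.RingSolver using (solve-∀)
  open import Data.Vec.Base using (here; there)
  open import Data.Vec.Properties using (lookup∘tabulate; lookup⇒[]=; []=⇒lookup)
  open import Relation.Nullary.Decidable using (dec-true; T?; _→-dec_)
  open ≡-Reasoning

  Coeffs : ℕ → Set
  Coeffs n = Subset n → ℤ

  -- Recursive form of `∂`, by whether the first vertex lies in `τ`, so that identities can be
  -- proved by induction on subsets. Adding vertex 0 puts it in front, with sign +; if 0 is already
  -- in `τ`, every added vertex stands one place further back, hence the minus sign.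
  boundary : Coeffs n → Coeffs n
  boundary f []          = 0ℤ
  boundary f (false ∷ τ) = f (true ∷ τ) + boundary (f ∘ (false ∷_)) τ
  boundary f (true  ∷ τ) = - boundary (f ∘ (true ∷_)) τ

  sum-neg : ∀ {n} (t : Fin n → ℤ) → sum (λ i → - t i) ≡ - sum t
  sum-neg {zero}  t = refl
  sum-neg {suc n} t = trans (cong (λ s → - t zero + s) (sum-neg (t ∘ suc)))
                            (sym (ℤ.neg-distrib-+ (t zero) (sum (t ∘ suc))))

  ∂≗boundary : (f : Coeffs n) → ∀ τ → ∂ f τ ≡ boundary f τ
  ∂≗boundary f [] = refl
  ∂≗boundary f (false ∷ τ) = cong₂ _+_
    (trans (ℤ.*-identityˡ _) (cong (f ∘ (true ∷_)) (∪-identityʳ τ)))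
    (∂≗boundary (f ∘ (false ∷_)) τ)
  ∂≗boundary f (true ∷ τ) = trans (ℤ.+-identityˡ _) (begin
    sum (∂-term f (true ∷ τ) ∘ suc)                ≡⟨ sum-cong-≗ term ⟩
    sum (λ v → - ∂-term (f ∘ (true ∷_)) τ v)       ≡⟨ sum-neg (∂-term (f ∘ (true ∷_)) τ) ⟩
    - ∂ (f ∘ (true ∷_)) τ                          ≡⟨ cong -_ (∂≗boundary (f ∘ (true ∷_)) τ) ⟩
    - boundary (f ∘ (true ∷_)) τ                   ∎)
    where
    term : ∀ v → ∂-term f (true ∷ τ) (suc v) ≡ - ∂-term (f ∘ (true ∷_)) τ v
    term v with does (v ∈? τ)
    ... | true  = refl
    ... | false = lemma (-1ℤ ^ rank v τ) _
      where
      lemma : ∀ s c → (-1ℤ * s) * c ≡ - (s * c)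
      lemma = solve-∀

  -- Chains are compared pointwise, so respect for pointwise equality is made part of linearity.
  record IsLinear (L : Coeffs k → Coeffs n) : Set where
    field
      ≗-cong : ∀ {f g} → (∀ σ → f σ ≡ g σ) → ∀ τ → L f τ ≡ L g τ
      +-homo : ∀ f g τ → L (λ σ → f σ + g σ) τ ≡ L f τ + L g τ
      *-homo : ∀ a f τ → L (λ σ → a * f σ) τ ≡ a * L f τ

    0-homo : ∀ {f} → (∀ σ → f σ ≡ 0ℤ) → ∀ τ → L f τ ≡ 0ℤ
    -- A product with left factor `0ℤ` computes to `0ℤ`, so both uses of `0ℤ * _` already read as
    -- `0ℤ`.
    0-homo {f} f≗0 τ = trans (≗-cong {g = λ σ → 0ℤ * f σ} f≗0 τ) (*-homo 0ℤ f τ)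

    neg-homo : ∀ f τ → L (λ σ → - f σ) τ ≡ - L f τ
    neg-homo f τ = begin
      L (λ σ → - f σ) τ        ≡⟨ ≗-cong (λ σ → sym (ℤ.-1*i≡-i (f σ))) τ ⟩
      L (λ σ → -1ℤ * f σ) τ    ≡⟨ *-homo -1ℤ f τ ⟩
      -1ℤ * L f τ              ≡⟨ ℤ.-1*i≡-i (L f τ) ⟩
      - L f τ                  ∎

    sub-homo : ∀ f g τ → L (λ σ → f σ - g σ) τ ≡ L f τ - L g τ
    sub-homo f g τ = trans (+-homo f (λ σ → - g σ) τ) (cong (λ x → L f τ + x) (neg-homo g τ))

  open IsLinear

  ∘-linear : ∀ {j} {L : Coeffs k → Coeffs n} {M : Coeffs j → Coeffs k} →
             IsLinear L → IsLinear M → IsLinear (L ∘ M)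
  ∘-linear {M = M} l m = record
    { ≗-cong = λ f≗g → ≗-cong l (≗-cong m f≗g)
    ; +-homo = λ f g τ → trans (≗-cong l (+-homo m f g) τ) (+-homo l (M f) (M g) τ)
    ; *-homo = λ a f τ → trans (≗-cong l (*-homo m a f) τ) (*-homo l a (M f) τ)
    }

  sub-linear : {L M : Coeffs k → Coeffs n} →
               IsLinear L → IsLinear M → IsLinear (λ f τ → L f τ - M f τ)
  sub-linear {L = L} {M} l m = record
    { ≗-cong = λ f≗g τ → cong₂ _-_ (≗-cong l f≗g τ) (≗-cong m f≗g τ)
    ; +-homo = λ f g τ → trans (cong₂ _-_ (+-homo l f g τ) (+-homo m f g τ))
                               (lemma (L f τ) (L g τ) (M f τ) (M g τ))
    ; *-homo = λ a f τ → trans (cong₂ _-_ (*-homo l a f τ) (*-homo m a f τ))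
                               (lemma′ a (L f τ) (M f τ))
    }
    where
    lemma : ∀ a b c d → (a + b) - (c + d) ≡ (a - c) + (b - d)
    lemma = solve-∀
    lemma′ : ∀ a b c → a * b - a * c ≡ a * (b - c)
    lemma′ = solve-∀

  id-linear : IsLinear {n} id
  id-linear = record { ≗-cong = id ; +-homo = λ _ _ _ → refl ; *-homo = λ _ _ _ → refl }

  boundary-linear : IsLinear {n} boundary
  boundary-linear = record { ≗-cong = ∂-cong ; +-homo = ∂-+ ; *-homo = ∂-* }
    where
    ∂-cong : {f g : Coeffs n} → (∀ σ → f σ ≡ g σ) → ∀ τ → boundary f τ ≡ boundary g τ
    ∂-cong f≗g []          = refl
    ∂-cong f≗g (false ∷ τ) = cong₂ _+_ (f≗g (true ∷ τ)) (∂-cong (f≗g ∘ (false ∷_)) τ)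
    ∂-cong f≗g (true  ∷ τ) = cong -_ (∂-cong (f≗g ∘ (true ∷_)) τ)

    ∂-+ : ∀ (f g : Coeffs n) τ → boundary (λ σ → f σ + g σ) τ ≡ boundary f τ + boundary g τ
    ∂-+ f g []          = refl
    ∂-+ f g (false ∷ τ) =
      trans (cong (λ x → f (true ∷ τ) + g (true ∷ τ) + x) (∂-+ (f ∘ (false ∷_)) (g ∘ (false ∷_)) τ))
            (lemma (f (true ∷ τ)) (g (true ∷ τ)) _ _)
      where
      lemma : ∀ a b c d → (a + b) + (c + d) ≡ (a + c) + (b + d)
      lemma = solve-∀
    ∂-+ f g (true ∷ τ) =
      trans (cong -_ (∂-+ (f ∘ (true ∷_)) (g ∘ (true ∷_)) τ))
            (ℤ.neg-distrib-+ (boundary (f ∘ (true ∷_)) τ) _)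

    ∂-* : ∀ a (f : Coeffs n) τ → boundary (λ σ → a * f σ) τ ≡ a * boundary f τ
    ∂-* a f []          = sym (ℤ.*-zeroʳ a)
    ∂-* a f (false ∷ τ) = trans (cong (λ x → a * f (true ∷ τ) + x) (∂-* a (f ∘ (false ∷_)) τ))
                                (sym (ℤ.*-distribˡ-+ a _ _))
    ∂-* a f (true  ∷ τ) = trans (cong -_ (∂-* a (f ∘ (true ∷_)) τ)) (ℤ.neg-distribʳ-* a _)

  -- Removing the first vertex before or after another one gives the same set with opposite signs;
  -- the terms not involving the first vertex cancel by induction.
  boundary² : (f : Coeffs n) → ∀ τ → boundary (boundary f) τ ≡ 0ℤ
  boundary² f []          = refl
  boundary² f (false ∷ τ) = begin
    - b₁ τ + boundary (λ σ → f (true ∷ σ) + b₀ σ) τ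
      ≡⟨ cong (λ x → - b₁ τ + x) (+-homo boundary-linear (f ∘ (true ∷_)) b₀ τ) ⟩
    - b₁ τ + (b₁ τ + boundary b₀ τ)
      ≡⟨ cong (λ x → - b₁ τ + (b₁ τ + x)) (boundary² (f ∘ (false ∷_)) τ) ⟩
    - b₁ τ + (b₁ τ + 0ℤ)
      ≡⟨ lemma (b₁ τ) ⟩
    0ℤ ∎
    where
    b₀ = boundary (f ∘ (false ∷_))
    b₁ = boundary (f ∘ (true ∷_))
    lemma : ∀ x → - x + (x + 0ℤ) ≡ 0ℤ
    lemma = solve-∀
  boundary² f (true ∷ τ) = begin
    - boundary (λ σ → - boundary (f ∘ (true ∷_)) σ) τ
      ≡⟨ cong -_ (neg-homo boundary-linear (boundary (f ∘ (true ∷_))) τ) ⟩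
    - (- boundary (boundary (f ∘ (true ∷_))) τ)
      ≡⟨ cong (λ x → - (- x)) (boundary² (f ∘ (true ∷_)) τ) ⟩
    0ℤ ∎

  -- Cones over a vertex.

  -- [v₀,…,v_k] ↦ [x,v₀,…,v_k]; the sign comes from moving x to its place in
  -- the order of Fin n.
  cone : Fin n → Coeffs n → Coeffs n
  cone zero    f (false ∷ τ) = 0ℤ
  cone zero    f (true  ∷ τ) = f (false ∷ τ)
  cone (suc x) f (false ∷ τ) = cone x (f ∘ (false ∷_)) τ
  cone (suc x) f (true  ∷ τ) = - cone x (f ∘ (true ∷_)) τ

  cone-linear : (x : Fin n) → IsLinear (cone x)
  cone-linear x = record { ≗-cong = c-cong x ; +-homo = c-+ x ; *-homo = c-* x }
    where
    c-cong : (x : Fin n) {f g : Coeffs n} → (∀ σ → f σ ≡ g σ) → ∀ τ → cone x f τ ≡ cone x g τ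
    c-cong zero    f≗g (false ∷ τ) = refl
    c-cong zero    f≗g (true  ∷ τ) = f≗g (false ∷ τ)
    c-cong (suc x) f≗g (false ∷ τ) = c-cong x (f≗g ∘ (false ∷_)) τ
    c-cong (suc x) f≗g (true  ∷ τ) = cong -_ (c-cong x (f≗g ∘ (true ∷_)) τ)

    c-+ : ∀ (x : Fin n) (f g : Coeffs n) τ → cone x (λ σ → f σ + g σ) τ ≡ cone x f τ + cone x g τ
    c-+ zero    f g (false ∷ τ) = refl
    c-+ zero    f g (true  ∷ τ) = refl
    c-+ (suc x) f g (false ∷ τ) = c-+ x (f ∘ (false ∷_)) (g ∘ (false ∷_)) τ
    c-+ (suc x) f g (true  ∷ τ) =
      trans (cong -_ (c-+ x (f ∘ (true ∷_)) (g ∘ (true ∷_)) τ))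
            (ℤ.neg-distrib-+ (cone x (f ∘ (true ∷_)) τ) _)

    c-* : ∀ (x : Fin n) a (f : Coeffs n) τ → cone x (λ σ → a * f σ) τ ≡ a * cone x f τ
    c-* zero    a f (false ∷ τ) = sym (ℤ.*-zeroʳ a)
    c-* zero    a f (true  ∷ τ) = refl
    c-* (suc x) a f (false ∷ τ) = c-* x a (f ∘ (false ∷_)) τ
    c-* (suc x) a f (true  ∷ τ) =
      trans (cong -_ (c-* x a (f ∘ (true ∷_)) τ)) (ℤ.neg-distribʳ-* a _)

  -- A cone is supported on sets containing `x`, while `cone x` reads only the coefficients of sets
  -- avoiding `x`.
  cone² : ∀ (x : Fin n) f τ → cone x (cone x f) τ ≡ 0ℤ
  cone² zero    f (false ∷ τ) = refl
  cone² zero    f (true  ∷ τ) = refl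
  cone² (suc x) f (false ∷ τ) = cone² x (f ∘ (false ∷_)) τ
  cone² (suc x) f (true  ∷ τ) = cong -_ (begin
    cone x (λ σ → - cone x (f ∘ (true ∷_)) σ) τ   ≡⟨ neg-homo (cone-linear x) _ τ ⟩
    - cone x (cone x (f ∘ (true ∷_))) τ           ≡⟨ cong -_ (cone² x (f ∘ (true ∷_)) τ) ⟩
    0ℤ                                            ∎)

  -- The formula ∂(x * c) = c - x * ∂c. On a set containing `x` the first term vanishes, and only
  -- the face opposite `x` survives in the second.
  cone-homotopy : ∀ (x : Fin n) f τ → boundary (cone x f) τ + cone x (boundary f) τ ≡ f τ
  cone-homotopy zero f (false ∷ τ) = begin
    f (false ∷ τ) + boundary (λ _ → 0ℤ) τ + 0ℤ   ≡⟨ ℤ.+-identityʳ _ ⟩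
    f (false ∷ τ) + boundary (λ _ → 0ℤ) τ
      ≡⟨ cong (λ x → f (false ∷ τ) + x) (0-homo boundary-linear (λ _ → refl) τ) ⟩
    f (false ∷ τ) + 0ℤ                           ≡⟨ ℤ.+-identityʳ _ ⟩
    f (false ∷ τ)                                ∎
  cone-homotopy zero f (true ∷ τ) = lemma (boundary (f ∘ (false ∷_)) τ) (f (true ∷ τ))
    where
    lemma : ∀ a b → - a + (b + a) ≡ b
    lemma = solve-∀
  cone-homotopy (suc x) f (false ∷ τ) = begin
    - c₁ + boundary (cone x f₀) τ + cone x (λ σ → f₁ σ + boundary f₀ σ) τ
      ≡⟨ cong (λ y → - c₁ + boundary (cone x f₀) τ + y) (+-homo (cone-linear x) f₁ (boundary f₀) τ) ⟩
    - c₁ + boundary (cone x f₀) τ + (c₁ + cone x (boundary f₀) τ)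
      ≡⟨ lemma c₁ _ _ ⟩
    boundary (cone x f₀) τ + cone x (boundary f₀) τ
      ≡⟨ cone-homotopy x f₀ τ ⟩
    f (false ∷ τ) ∎
    where
    f₀ = f ∘ (false ∷_)
    f₁ = f ∘ (true ∷_)
    c₁ = cone x f₁ τ
    lemma : ∀ a b c → - a + b + (a + c) ≡ b + c
    lemma = solve-∀
  cone-homotopy (suc x) f (true ∷ τ) = begin
    - boundary (λ σ → - cone x f₁ σ) τ + - cone x (λ σ → - boundary f₁ σ) τ
      ≡⟨ cong₂ (λ a b → - a + - b) (neg-homo boundary-linear (cone x f₁) τ)
                                   (neg-homo (cone-linear x) (boundary f₁) τ) ⟩
    - (- boundary (cone x f₁) τ) + - (- cone x (boundary f₁) τ)
      ≡⟨ cong₂ _+_ (ℤ.neg-involutive (boundary (cone x f₁) τ))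
                   (ℤ.neg-involutive (cone x (boundary f₁) τ)) ⟩
    boundary (cone x f₁) τ + cone x (boundary f₁) τ
      ≡⟨ cone-homotopy x f₁ τ ⟩
    f (true ∷ τ) ∎
    where
    f₁ = f ∘ (true ∷_)

  -- Sums over all subsets, basis chains and supports.

  Σs : (Subset n → ℤ) → ℤ
  Σs {zero}  f = f []
  Σs {suc n} f = Σs (f ∘ (false ∷_)) + Σs (f ∘ (true ∷_))

  Σs-cong : {f g : Subset n → ℤ} → (∀ σ → f σ ≡ g σ) → Σs f ≡ Σs g
  Σs-cong {zero}  f≗g = f≗g []
  Σs-cong {suc n} f≗g = cong₂ _+_ (Σs-cong (f≗g ∘ (false ∷_))) (Σs-cong (f≗g ∘ (true ∷_)))

  Σs-0 : {f : Subset n → ℤ} → (∀ σ → f σ ≡ 0ℤ) → Σs f ≡ 0ℤ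
  Σs-0 {zero}  f≗0 = f≗0 []
  Σs-0 {suc n} f≗0 = cong₂ _+_ (Σs-0 (f≗0 ∘ (false ∷_))) (Σs-0 (f≗0 ∘ (true ∷_)))

  Σs-+ : (f g : Subset n → ℤ) → Σs (λ σ → f σ + g σ) ≡ Σs f + Σs g
  Σs-+ {zero}  f g = refl
  Σs-+ {suc n} f g = trans
    (cong₂ _+_ (Σs-+ (f ∘ (false ∷_)) (g ∘ (false ∷_))) (Σs-+ (f ∘ (true ∷_)) (g ∘ (true ∷_))))
    (lemma (Σs (f ∘ (false ∷_))) (Σs (g ∘ (false ∷_))) _ _)
    where
    lemma : ∀ a b c d → (a + b) + (c + d) ≡ (a + c) + (b + d)
    lemma = solve-∀

  Σs-* : ∀ a (f : Subset n → ℤ) → Σs (λ σ → a * f σ) ≡ a * Σs f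
  Σs-* {zero}  a f = refl
  Σs-* {suc n} a f = trans (cong₂ _+_ (Σs-* a (f ∘ (false ∷_))) (Σs-* a (f ∘ (true ∷_))))
                           (sym (ℤ.*-distribˡ-+ a _ _))

  Σs-≢0 : (f : Subset n → ℤ) → Σs f ≢ 0ℤ → ∃[ σ ] f σ ≢ 0ℤ
  Σs-≢0 {zero}  f f≢0 = [] , f≢0
  Σs-≢0 {suc n} f f≢0 with Σs (f ∘ (false ∷_)) ℤ.≟ 0ℤ | Σs (f ∘ (true ∷_)) ℤ.≟ 0ℤ
  ... | no f₀≢0  | _        = let σ , fσ≢0 = Σs-≢0 _ f₀≢0 in false ∷ σ , fσ≢0
  ... | yes _    | no f₁≢0  = let σ , fσ≢0 = Σs-≢0 _ f₁≢0 in true ∷ σ , fσ≢0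
  ... | yes f₀≡0 | yes f₁≡0 = contradiction (cong₂ _+_ f₀≡0 f₁≡0) f≢0

  linear-Σs : ∀ {j} {L : Coeffs k → Coeffs n} → IsLinear L → (g : Subset j → Coeffs k) →
              ∀ τ → L (λ ρ → Σs (λ σ → g σ ρ)) τ ≡ Σs (λ σ → L (g σ) τ)
  linear-Σs {j = zero}  l g τ = refl
  linear-Σs {j = suc j} l g τ = trans (+-homo l _ _ τ)
    (cong₂ _+_ (linear-Σs l (g ∘ (false ∷_)) τ) (linear-Σs l (g ∘ (true ∷_)) τ))

  -- The basis chain written [σ].
  δ : Subset n → Coeffs n
  δ []          []          = 1ℤ
  δ (false ∷ σ) (false ∷ τ) = δ σ τ
  δ (false ∷ σ) (true  ∷ τ) = 0ℤ
  δ (true  ∷ σ) (false ∷ τ) = 0ℤ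
  δ (true  ∷ σ) (true  ∷ τ) = δ σ τ

  δ-support : ∀ (σ τ : Subset n) → δ σ τ ≢ 0ℤ → τ ≡ σ
  δ-support []          []          _   = refl
  δ-support (false ∷ σ) (false ∷ τ) ≢0 = cong (false ∷_) (δ-support σ τ ≢0)
  δ-support (false ∷ σ) (true  ∷ τ) ≢0 = contradiction refl ≢0
  δ-support (true  ∷ σ) (false ∷ τ) ≢0 = contradiction refl ≢0
  δ-support (true  ∷ σ) (true  ∷ τ) ≢0 = cong (true ∷_) (δ-support σ τ ≢0)

  δ-sym : ∀ (σ τ : Subset n) → δ σ τ ≡ δ τ σ
  δ-sym []          []          = refl
  δ-sym (false ∷ σ) (false ∷ τ) = δ-sym σ τ
  δ-sym (false ∷ σ) (true  ∷ τ) = refl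
  δ-sym (true  ∷ σ) (false ∷ τ) = refl
  δ-sym (true  ∷ σ) (true  ∷ τ) = δ-sym σ τ

  Σs-δ : ∀ σ (f : Subset n → ℤ) → Σs (λ τ → δ σ τ * f τ) ≡ f σ
  Σs-δ []          f = ℤ.*-identityˡ (f [])
  Σs-δ (false ∷ σ) f = trans (cong₂ _+_ (Σs-δ σ (f ∘ (false ∷_)))
                                        (Σs-0 {f = λ τ → 0ℤ * f (true ∷ τ)} (λ _ → refl)))
                             (ℤ.+-identityʳ _)
  Σs-δ (true  ∷ σ) f = trans (cong₂ _+_ (Σs-0 {f = λ τ → 0ℤ * f (false ∷ τ)} (λ _ → refl))
                                        (Σs-δ σ (f ∘ (true ∷_))))
                             (ℤ.+-identityˡ _)

  -- Every chain is the combination of basis chains with its own coefficients, so a linear map is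
  -- determined by its values on these. This reduces questions of support and vanishing to single
  -- sets.
  expand : ∀ {L : Coeffs k → Coeffs n} → IsLinear L →
           ∀ f τ → L f τ ≡ Σs (λ σ → f σ * L (δ σ) τ)
  expand {L = L} l f τ = begin
    L f τ
      ≡⟨ ≗-cong l (λ ρ → sym (trans (Σs-cong λ σ → trans (ℤ.*-comm (f σ) (δ σ ρ))
                                                         (cong (_* f σ) (δ-sym σ ρ)))
                                    (Σs-δ ρ f))) τ ⟩
    L (λ ρ → Σs (λ σ → f σ * δ σ ρ)) τ
      ≡⟨ linear-Σs l (λ σ ρ → f σ * δ σ ρ) τ ⟩
    Σs (λ σ → L (λ ρ → f σ * δ σ ρ) τ)
      ≡⟨ Σs-cong (λ σ → *-homo l (f σ) (δ σ) τ) ⟩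
    Σs (λ σ → f σ * L (δ σ) τ) ∎

  *-≢0 : ∀ a b → a * b ≢ 0ℤ → a ≢ 0ℤ × b ≢ 0ℤ
  *-≢0 a b ab≢0 = (λ { refl → ab≢0 refl }) , (λ { refl → ab≢0 (ℤ.*-zeroʳ a) })

  expand-support : ∀ {L : Coeffs k → Coeffs n} → IsLinear L → ∀ f τ → L f τ ≢ 0ℤ →
                   ∃[ σ ] f σ ≢ 0ℤ × L (δ σ) τ ≢ 0ℤ
  expand-support {L = L} l f τ Lf≢0 =
    let σ , ≢0 = Σs-≢0 _ (Lf≢0 ∘ trans (expand l f τ)) in σ , *-≢0 (f σ) (L (δ σ) τ) ≢0

  expand-zero : ∀ {L : Coeffs k → Coeffs n} → IsLinear L → ∀ f τ →
                (∀ σ → f σ ≢ 0ℤ → L (δ σ) τ ≡ 0ℤ) → L f τ ≡ 0ℤ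
  expand-zero {L = L} l f τ L≗0 = trans (expand l f τ) (Σs-0 term)
    where
    term : ∀ σ → f σ * L (δ σ) τ ≡ 0ℤ
    term σ with f σ ℤ.≟ 0ℤ
    ... | yes f≡0 = cong (_* L (δ σ) τ) f≡0
    ... | no  f≢0 = trans (cong (f σ *_) (L≗0 σ f≢0)) (ℤ.*-zeroʳ (f σ))

  -≢0 : ∀ {a} → - a ≢ 0ℤ → a ≢ 0ℤ
  -≢0 -a≢0 refl = -a≢0 refl

  boundary-support : ∀ (f : Coeffs n) τ → boundary f τ ≢ 0ℤ →
                     ∃[ σ ] f σ ≢ 0ℤ × ∣ σ ∣ ≡ suc ∣ τ ∣ × τ ⊆ σ
  boundary-support f [] ≢0 = contradiction refl ≢0
  boundary-support f (false ∷ τ) ≢0 with f (true ∷ τ) ℤ.≟ 0ℤ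
  ... | no  f≢0 = true ∷ τ , f≢0 , refl , out⊆ id
  ... | yes f≡0 =
    let σ , f≢0 , card , τ⊆σ = boundary-support (f ∘ (false ∷_)) τ
                                 (λ b≡0 → ≢0 (cong₂ _+_ f≡0 b≡0))
    in false ∷ σ , f≢0 , card , s⊆s τ⊆σ
  boundary-support f (true ∷ τ) ≢0 =
    let σ , f≢0 , card , τ⊆σ = boundary-support (f ∘ (true ∷_)) τ (-≢0 ≢0)
    in true ∷ σ , f≢0 , cong suc card , s⊆s τ⊆σ

  boundary-δ-support : ∀ (σ τ : Subset n) → boundary (δ σ) τ ≢ 0ℤ → ∣ σ ∣ ≡ suc ∣ τ ∣ × τ ⊆ σ
  boundary-δ-support σ τ ≢0 with boundary-support (δ σ) τ ≢0
  ... | ρ , δ≢0 , card , τ⊆ρ with refl ← δ-support σ ρ δ≢0 = card , τ⊆ρ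

  cone-support : ∀ (x : Fin n) f τ → cone x f τ ≢ 0ℤ →
                 ∃[ σ ] f σ ≢ 0ℤ × ∣ τ ∣ ≡ suc ∣ σ ∣ × (∀ {v} → v ∈ τ → v ≡ x ⊎ v ∈ σ)
  cone-support zero f (false ∷ τ) ≢0 = contradiction refl ≢0
  cone-support zero f (true  ∷ τ) ≢0 = false ∷ τ , ≢0 , refl , λ where
    here        → inj₁ refl
    (there v∈τ) → inj₂ (there v∈τ)
  cone-support (suc x) f (false ∷ τ) ≢0 =
    let σ , f≢0 , card , τ⊆ = cone-support x (f ∘ (false ∷_)) τ ≢0
    in false ∷ σ , f≢0 , card , λ where
      (there v∈τ) → Sum.map (cong suc) there (τ⊆ v∈τ)
  cone-support (suc x) f (true ∷ τ) ≢0 =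
    let σ , f≢0 , card , τ⊆ = cone-support x (f ∘ (true ∷_)) τ (-≢0 ≢0)
    in true ∷ σ , f≢0 , cong suc card , λ where
      here        → inj₂ here
      (there v∈τ) → Sum.map (cong suc) there (τ⊆ v∈τ)

  -- The homotopy defined by a choice of apexes.

  module ApexHomotopy {n : ℕ} (apex : Subset n → Fin n) where

    -- Meant for chains of sets of size k: the recursion then stops at the empty
    -- set, for which no suitable apex need exist.
    homotopy : ℕ → Coeffs n → Coeffs n
    prism    : ℕ → Subset n → Coeffs n

    homotopy zero    f τ = 0ℤ
    homotopy (suc k) f τ = Σs λ σ → f σ * prism k σ τ

    -- Here `σ` is meant to have size `suc k`; the index `k` is the size of its faces, on which the
    -- homotopy is already defined.
    prism k σ = cone (apex σ) λ τ → δ σ τ - homotopy k (boundary (δ σ)) τ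

    homotopy-δ : ∀ k σ τ → homotopy (suc k) (δ σ) τ ≡ prism k σ τ
    homotopy-δ k σ τ = Σs-δ σ (λ ρ → prism k ρ τ)

    homotopy-linear : ∀ k → IsLinear (homotopy k)
    homotopy-linear zero = record
      { ≗-cong = λ _ _ → refl ; +-homo = λ _ _ _ → refl ; *-homo = λ a _ _ → sym (ℤ.*-zeroʳ a) }
    homotopy-linear (suc k) = record
      { ≗-cong = λ f≗g τ → Σs-cong λ σ → cong (_* prism k σ τ) (f≗g σ)
      ; +-homo = λ f g τ → trans (Σs-cong λ σ → ℤ.*-distribʳ-+ (prism k σ τ) (f σ) (g σ))
                                 (Σs-+ (λ σ → f σ * prism k σ τ) (λ σ → g σ * prism k σ τ))
      ; *-homo = λ a f τ → trans (Σs-cong λ σ → ℤ.*-assoc a (f σ) (prism k σ τ))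
                                 (Σs-* a (λ σ → f σ * prism k σ τ))
      }

    -- id - ∂h - h∂, the chain map φ.
    residue : ℕ → Coeffs n → Coeffs n
    residue k f τ = f τ - boundary (homotopy k f) τ - homotopy (ℕ.pred k) (boundary f) τ

    residue-linear : ∀ k → IsLinear (residue k)
    residue-linear k = sub-linear
      (sub-linear id-linear (∘-linear boundary-linear (homotopy-linear k)))
      (∘-linear (homotopy-linear (ℕ.pred k)) boundary-linear)

    -- Put w = [σ] - h∂[σ], so that h[σ] = x * w. Then φ[σ] = w - ∂(x * w) = x * ∂w by the cone
    -- formula, and ∂w = ∂[σ] - ∂h∂[σ] is φ∂[σ] because ∂∂[σ] = 0.
    residue-cone : ∀ k σ τ →
      residue (suc k) (δ σ) τ ≡ cone (apex σ) (residue k (boundary (δ σ))) τ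
    residue-cone k σ τ = begin
      δ σ τ - boundary (homotopy (suc k) (δ σ)) τ - hb τ
        ≡⟨ cong (λ x → δ σ τ - x - hb τ) (≗-cong boundary-linear (homotopy-δ k σ) τ) ⟩
      δ σ τ - boundary (cone x w) τ - hb τ
        ≡⟨ lemma (δ σ τ) (hb τ) (boundary (cone x w) τ) ⟩
      w τ - boundary (cone x w) τ
        ≡⟨ cong (_- boundary (cone x w) τ) (sym (cone-homotopy x w τ)) ⟩
      boundary (cone x w) τ + cone x (boundary w) τ - boundary (cone x w) τ
        ≡⟨ lemma′ (boundary (cone x w) τ) (cone x (boundary w) τ) ⟩
      cone x (boundary w) τ
        ≡⟨ ≗-cong (cone-linear x) ∂w τ ⟩
      cone x (residue k (boundary (δ σ))) τ ∎
      where
      x  = apex σ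
      hb = homotopy k (boundary (δ σ))
      w : Coeffs n
      w ρ = δ σ ρ - hb ρ
      ∂w : ∀ ρ → boundary w ρ ≡ residue k (boundary (δ σ)) ρ
      ∂w ρ = begin
        boundary w ρ
          ≡⟨ sub-homo boundary-linear (δ σ) hb ρ ⟩
        boundary (δ σ) ρ - boundary hb ρ
          ≡⟨ ℤ.+-identityʳ _ ⟨
        boundary (δ σ) ρ - boundary hb ρ - 0ℤ
          ≡⟨ cong (λ y → boundary (δ σ) ρ - boundary hb ρ - y)
               (0-homo (homotopy-linear (ℕ.pred k)) (boundary² (δ σ)) ρ) ⟨
        residue k (boundary (δ σ)) ρ ∎
      lemma : ∀ a b c → a - c - b ≡ a - b - c
      lemma = solve-∀
      lemma′ : ∀ a b → a + b - a ≡ b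
      lemma′ = solve-∀

    -- As ∂z = 0, the chain z is its residue plus ∂hz, and the residue of z vanishes with those of
    -- the basis chains in its support.
    cycle-boundary : ∀ k (z : Coeffs n) → (∀ τ → boundary z τ ≡ 0ℤ) →
                     (∀ σ → z σ ≢ 0ℤ → ∀ τ → residue k (δ σ) τ ≡ 0ℤ) →
                     ∀ τ → z τ ≡ boundary (homotopy k z) τ
    cycle-boundary k z ∂z≗0 residue≗0 τ = begin
      z τ
        ≡⟨ lemma (z τ) (boundary (homotopy k z) τ) (homotopy (ℕ.pred k) (boundary z) τ) ⟩
      residue k z τ + (boundary (homotopy k z) τ + homotopy (ℕ.pred k) (boundary z) τ)
        ≡⟨ cong₂ (λ a b → a + (boundary (homotopy k z) τ + b))
             (expand-zero (residue-linear k) z τ (λ σ zσ≢0 → residue≗0 σ zσ≢0 τ))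
             (0-homo (homotopy-linear (ℕ.pred k)) ∂z≗0 τ) ⟩
      0ℤ + (boundary (homotopy k z) τ + 0ℤ)
        ≡⟨ lemma′ (boundary (homotopy k z) τ) ⟩
      boundary (homotopy k z) τ ∎
      where
      lemma : ∀ a b c → a ≡ (a - b - c) + (b + c)
      lemma = solve-∀
      lemma′ : ∀ a → 0ℤ + (a + 0ℤ) ≡ a
      lemma′ = solve-∀

  -- Cardinalities of subsets.

  ∣σ∣>0⇒Nonempty : ∀ (σ : Subset n) → ∣ σ ∣ ≡ suc k → Nonempty σ
  ∣σ∣>0⇒Nonempty (true  ∷ σ) _    = zero , here
  ∣σ∣>0⇒Nonempty (false ∷ σ) card = let v , v∈σ = ∣σ∣>0⇒Nonempty σ card in suc v , there v∈σ

  -- Applied to the common neighbours of a set and of one of its faces: either the apex is the same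
  -- or the number of common neighbours grows.
  ⊆⇒≡⊎< : ∀ {σ τ : Subset n} → σ ⊆ τ → σ ≡ τ ⊎ ∣ σ ∣ ℕ.< ∣ τ ∣
  ⊆⇒≡⊎< {σ = []} {[]} _ = inj₁ refl
  ⊆⇒≡⊎< {σ = true ∷ σ} {false ∷ τ} σ⊆τ = contradiction (σ⊆τ here) λ ()
  ⊆⇒≡⊎< {σ = false ∷ σ} {true ∷ τ} σ⊆τ = inj₂ (ℕ.s≤s (p⊆q⇒∣p∣≤∣q∣ (drop-∷-⊆ σ⊆τ)))
  ⊆⇒≡⊎< {σ = false ∷ σ} {false ∷ τ} σ⊆τ =
    Sum.map (cong (false ∷_)) id (⊆⇒≡⊎< (drop-∷-⊆ σ⊆τ))
  ⊆⇒≡⊎< {σ = true ∷ σ} {true ∷ τ} σ⊆τ =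
    Sum.map (cong (true ∷_)) ℕ.s≤s (⊆⇒≡⊎< (drop-∷-⊆ σ⊆τ))

  ⊆-of-size : ∀ (ν : Subset n) → k ℕ.≤ ∣ ν ∣ → ∃[ ρ ] ρ ⊆ ν × ∣ ρ ∣ ≡ k
  ⊆-of-size []          z≤n       = [] , id , refl
  ⊆-of-size (false ∷ ν) k≤        = let ρ , ρ⊆ν , eq = ⊆-of-size ν k≤ in false ∷ ρ , out⊆ ρ⊆ν , eq
  ⊆-of-size (true  ∷ ν) z≤n       = let ρ , ρ⊆ν , eq = ⊆-of-size ν z≤n in false ∷ ρ , out⊆ ρ⊆ν , eq
  ⊆-of-size (true  ∷ ν) (s≤s k≤)  = let ρ , ρ⊆ν , eq = ⊆-of-size ν k≤ in true ∷ ρ , s⊆s ρ⊆ν , cong suc eq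

  comprehension : ∀ {P : Fin n → Set} → (∀ v → Dec (P v)) → Subset n
  comprehension P? = tabulate (does ∘ P?)

  ∈-comprehension⁺ : ∀ {P : Fin n → Set} (P? : ∀ v → Dec (P v)) {v} → P v → v ∈ comprehension P?
  ∈-comprehension⁺ P? {v} pv = lookup⇒[]= v (tabulate (does ∘ P?))
    (trans (lookup∘tabulate (does ∘ P?) v) (dec-true (P? v) pv))

  ∈-comprehension⁻ : ∀ {P : Fin n → Set} (P? : ∀ v → Dec (P v)) {v} → v ∈ comprehension P? → P v
  ∈-comprehension⁻ P? {v} v∈ =
    does-true (P? v) (trans (sym (lookup∘tabulate (does ∘ P?) v)) ([]=⇒lookup v∈))
    where
    does-true : ∀ {A : Set} (A? : Dec A) → does A? ≡ true → A
    does-true (yes a) _ = a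

  -- Common neighbours and the homology of the multineighbor complex.

  module MultineighborHomology {n} (G : Graph n) (v₀ : Fin n) where

    private
      V : Set
      V = Subset n

    CommonNeighbor : V → Fin n → Set
    CommonNeighbor σ v = ∀ u → u ∈ σ → T (adjacent G u v)

    commonNeighbor? : ∀ σ v → Dec (CommonNeighbor σ v)
    commonNeighbor? σ v = all? λ u → (u ∈? σ) →-dec T? (adjacent G u v)

    common : V → V
    common σ = comprehension (commonNeighbor? σ)

    ∈-common⁺ : ∀ σ {v} → CommonNeighbor σ v → v ∈ common σ
    ∈-common⁺ σ = ∈-comprehension⁺ (commonNeighbor? σ)

    ∈-common⁻ : ∀ σ {v} → v ∈ common σ → CommonNeighbor σ v
    ∈-common⁻ σ = ∈-comprehension⁻ (commonNeighbor? σ)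

    common-anti : ∀ σ τ → σ ⊆ τ → common τ ⊆ common σ
    common-anti σ τ σ⊆τ v∈ = ∈-common⁺ σ λ u u∈σ → ∈-common⁻ τ v∈ u (σ⊆τ u∈σ)

    AdjacentTo : V → Fin n → Set
    AdjacentTo ν u = ∀ v → v ∈ ν → T (adjacent G u v)

    vertexAdjacentTo? : ∀ ν → Dec (∃ (AdjacentTo ν))
    vertexAdjacentTo? ν = any? λ u → all? λ v → (v ∈? ν) →-dec T? (adjacent G u v)

    -- The apex of σ depends only on the common neighbours of σ; the value v₀
    -- is junk, taken only when no vertex is adjacent to all of ν.
    vertexAdjacentTo : V → Fin n
    vertexAdjacentTo ν with vertexAdjacentTo? ν
    ... | yes (u , _) = u
    ... | no  _       = v₀

    apex : V → Fin n
    apex = vertexAdjacentTo ∘ common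

    -- Any element of `σ` is adjacent to all of `common σ`, so for nonempty `σ` the search for an
    -- apex succeeds.
    apex-adjacent : ∀ σ → Nonempty σ → AdjacentTo (common σ) (apex σ)
    apex-adjacent σ (u , u∈σ) with vertexAdjacentTo? (common σ)
    ... | yes (_ , adj) = adj
    ... | no  none      = contradiction (u , λ v v∈ → ∈-common⁻ σ v∈ u u∈σ) none

    open ApexHomotopy apex

    -- A set in the support of h[σ] consists of elements of `σ`, the apex, and vertices from the
    -- homotopy of a face. A face has at least the common neighbours of `σ`, so by induction all
    -- these vertices are adjacent to `common σ`.
    homotopy-support : ∀ k {σ τ} → ∣ σ ∣ ≡ k → homotopy k (δ σ) τ ≢ 0ℤ →
                       ∣ τ ∣ ≡ suc k × (∀ {u} → u ∈ τ → AdjacentTo (common σ) u)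
    homotopy-support zero    _  ≢0 = contradiction refl ≢0
    homotopy-support (suc k) {σ} {τ} ∣σ∣≡ ≢0 =
      let ρ , w≢0 , card , τ⊆ = cone-support (apex σ) w τ (≢0 ∘ trans (homotopy-δ k σ τ))
          card′ , adj = w-support ρ w≢0
      in trans card (cong suc card′) , λ u∈τ → adj′ adj (τ⊆ u∈τ)
      where
      w : Coeffs n
      w ρ = δ σ ρ - homotopy k (boundary (δ σ)) ρ

      adj′ : ∀ {u ρ} → (∀ {u} → u ∈ ρ → AdjacentTo (common σ) u) →
             u ≡ apex σ ⊎ u ∈ ρ → AdjacentTo (common σ) u
      adj′ adj (inj₁ refl) = apex-adjacent σ (∣σ∣>0⇒Nonempty σ ∣σ∣≡)
      adj′ adj (inj₂ u∈ρ)  = adj u∈ρ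

      w-support : ∀ ρ → w ρ ≢ 0ℤ → ∣ ρ ∣ ≡ suc k × (∀ {u} → u ∈ ρ → AdjacentTo (common σ) u)
      w-support ρ w≢0 with δ σ ρ ℤ.≟ 0ℤ | homotopy k (boundary (δ σ)) ρ ℤ.≟ 0ℤ
      ... | yes δ≡0 | yes h≡0 = contradiction (cong₂ _-_ δ≡0 h≡0) w≢0
      ... | no  δ≢0 | _ with refl ← δ-support σ ρ δ≢0 =
        ∣σ∣≡ , λ u∈σ v v∈ → ∈-common⁻ σ v∈ _ u∈σ
      ... | yes _   | no  h≢0 with expand-support (homotopy-linear k) (boundary (δ σ)) ρ h≢0
      ...   | π , ∂δ≢0 , hδ≢0 with boundary-δ-support σ π ∂δ≢0
      ...     | card , π⊆σ with homotopy-support k (ℕ.suc-injective (trans (sym card) ∣σ∣≡)) hδ≢0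
      ...       | card′ , adj = card′ , λ u∈ρ v v∈ → adj u∈ρ v (common-anti π σ π⊆σ v∈)

    -- If the residue does not vanish, the apex changes at each step of some flag
    -- from σ down to a set of size a+1, so at each step the number of common
    -- neighbours grows.
    residue-vanishes : ∀ {a b} → (∀ τ → ∣ τ ∣ ≡ suc a → ∣ common τ ∣ ℕ.< b) →
                       ∀ j σ → ∣ σ ∣ ≡ suc (j ℕ.+ a) → b ℕ.≤ j ℕ.+ ∣ common σ ∣ →
                       ∀ ρ → residue (suc (j ℕ.+ a)) (δ σ) ρ ≡ 0ℤ
    -- No removals are left: `σ` has `suc a` vertices and at least `b` common neighbours.
    residue-vanishes few zero    σ ∣σ∣≡ b≤ ρ = contradiction b≤ (ℕ.<⇒≱ (few σ ∣σ∣≡))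
    residue-vanishes {a} {b} few (suc j) σ ∣σ∣≡ b≤ ρ =
      trans (residue-cone (suc (j ℕ.+ a)) σ ρ)
            (expand-zero (∘-linear (cone-linear x) (residue-linear (suc (j ℕ.+ a))))
              (boundary (δ σ)) ρ λ τ ∂δ≢0 →
                let card , τ⊆σ = boundary-δ-support σ τ ∂δ≢0
                in faces τ (ℕ.suc-injective (trans (sym card) ∣σ∣≡)) τ⊆σ)
      where
      x = apex σ
      r = residue (suc (j ℕ.+ a))

      faces : ∀ τ → ∣ τ ∣ ≡ suc (j ℕ.+ a) → τ ⊆ σ → cone x (r (δ τ)) ρ ≡ 0ℤ
      faces τ ∣τ∣≡ τ⊆σ with ⊆⇒≡⊎< (common-anti τ σ τ⊆σ)
      -- Equal common neighbours give `τ` the apex `x` as well, so its residue is a cone over `x`,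
      -- killed by the second cone.
      ... | inj₁ same = trans
        (IsLinear.≗-cong (cone-linear x) (λ π → trans (residue-cone (j ℕ.+ a) τ π)
          (cong (λ y → cone (vertexAdjacentTo y) (residue (j ℕ.+ a) (boundary (δ τ))) π) (sym same))) ρ)
        (cone² x _ ρ)
      -- The gain of at least one common neighbour makes up for the decrease of `j`.
      ... | inj₂ more = IsLinear.0-homo (cone-linear x)
        (residue-vanishes few j τ ∣τ∣≡
          (ℕ.≤-trans b≤ (subst (ℕ._≤ j ℕ.+ ∣ common τ ∣) (ℕ.+-suc j ∣ common σ ∣) (ℕ.+-monoʳ-≤ j more)))) ρ

    module _ (m : ℕ) where

      private
        K = multineighborComplex m G

      common-card : ∀ σ → Nonempty σ → Face K σ → m ℕ.≤ ∣ common σ ∣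
      common-card σ ne face =
        let ν , cn , m≤ = face ne
        in ℕ.≤-trans m≤ (p⊆q⇒∣p∣≤∣q∣ λ v∈ν → ∈-common⁺ σ λ u u∈σ → cn u∈σ v∈ν)

      -- A q-simplex has `suc (j + a)` vertices and at least `m` common neighbours. A flag losing
      -- `j` vertices with a gain at each step would end at `suc a` vertices with at least `j + m`,
      -- hence `b`, common neighbours, against `few`.
      homology-vanishes : ∀ {a b} j q → (∀ τ → ∣ τ ∣ ≡ suc a → ∣ common τ ∣ ℕ.< b) →
                          b ℕ.≤ j ℕ.+ m → + suc (j ℕ.+ a) ≡ ℤ.suc q → IsTrivial (H̃ q K)
      homology-vanishes {a} {b} j q few b≤ q≡ z = bounding , λ σ → begin
        c σ - 0ℤ                     ≡⟨ ℤ.+-identityʳ (c σ) ⟩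
        c σ                          ≡⟨ cycle-boundary s c ∂c≗0 residue≗0 σ ⟩
        boundary (homotopy s c) σ    ≡⟨ ∂≗boundary (homotopy s c) σ ⟨
        ∂ (homotopy s c) σ           ∎
        where
        s = suc (j ℕ.+ a)
        c = coeff (chain z)

        card : ∀ σ → + ∣ σ ∣ ≡ ℤ.suc q → ∣ σ ∣ ≡ s
        card _ eq = ℤ.+-injective (trans eq (sym q≡))

        ∂c≗0 : ∀ τ → boundary c τ ≡ 0ℤ
        ∂c≗0 τ = trans (sym (∂≗boundary c τ)) (closed z τ)

        residue≗0 : ∀ σ → c σ ≢ 0ℤ → ∀ τ → residue s (δ σ) τ ≡ 0ℤ
        residue≗0 σ c≢0 =
          let face , dim = support (chain z) σ c≢0
          in residue-vanishes few j σ (card σ dim)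
               (ℕ.≤-trans b≤ (ℕ.+-monoʳ-≤ j (common-card σ (∣σ∣>0⇒Nonempty σ (card σ dim)) face)))

        bounding : Chain K (ℤ.suc q)
        bounding = record
          { coeff   = homotopy s c
          ; support = λ τ ≢0 →
              let σ , c≢0 , h≢0 = expand-support (homotopy-linear s) c τ ≢0
                  face , dim    = support (chain z) σ c≢0
                  ∣τ∣≡ , adj    = homotopy-support s (card σ dim) h≢0
              -- All of `τ` is adjacent to the common neighbours of the face `σ`, and these number
              -- at least `m`.
              in (λ _ → common σ , (λ u∈τ v∈ → adj u∈τ _ v∈)
                       , common-card σ (∣σ∣>0⇒Nonempty σ (card σ dim)) face)
               , trans (cong +_ ∣τ∣≡) (cong ℤ.suc q≡)
          }

-- Exponential inequalities in natural numbers.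

module ExponentBounds where

  open import Data.Nat.Base using (_+_; _*_; _^_; _≤_; _<_)
  open import Data.Nat.Tactic.RingSolver using (solve-∀)

  half : ∀ l → ∃[ b ] ∃[ s ] b ≤ 1 × l ≡ b + (s + s)
  half zero          = 0 , 0 , z≤n , refl
  half (suc zero)    = 1 , 0 , s≤s z≤n , refl
  half (suc (suc l)) =
    let b , s , b≤1 , eq = half l
    in b , suc s , b≤1 , trans (cong (2 +_) eq) (lemma b s)
    where
    lemma : ∀ b s → 2 + (b + (s + s)) ≡ b + ((1 + s) + (1 + s))
    lemma = solve-∀

  n<2^n : ∀ n → n < 2 ^ n
  n<2^n zero    = ℕ.≤-refl
  n<2^n (suc n) = begin-strict
    suc n                      <⟨ s≤s (n<2^n n) ⟩
    1 + 2 ^ n              ≤⟨ ℕ.+-mono-≤ (ℕ.m^n>0 2 n) (ℕ.m≤m+n (2 ^ n) 0) ⟩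
    2 ^ n + (2 ^ n + 0) ∎
    where open ℕ.≤-Reasoning

  2^-cancel-≤ : ∀ {a b} → 2 ^ a ≤ 2 ^ b → a ≤ b
  2^-cancel-≤ 2^a≤2^b = ℕ.≮⇒≥ λ b<a → ℕ.<⇒≱ (ℕ.^-monoʳ-< 2 (s≤s (s≤s z≤n)) b<a) 2^a≤2^b

  *-^ : ∀ x y k → (x * y) ^ k ≡ x ^ k * y ^ k
  *-^ x y zero    = refl
  *-^ x y (suc k) = trans (cong (x * y *_) (*-^ x y k)) (lemma x y (x ^ k) (y ^ k))
    where
    lemma : ∀ x y u v → (x * y) * (u * v) ≡ (x * u) * (y * v)
    lemma = solve-∀

  -- The sides of the bicliques have sizes ⌊(l+2)/2⌋ = s+1 and ⌈(l+2)/2⌉ = b+s+1.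
  -- Comparing fourth powers avoids fractional exponents.
  biclique-count : ∀ n d b s → b ≤ 1 → d ≤ s → n ^ 4 ≤ 2 ^ (b + (s + s)) →
    d * n ^ (suc s + suc (b + s)) < 2 ^ (suc s * suc (b + s))
  biclique-count n d b s b≤1 d≤s n⁴≤2^l = ℕ.≰⇒> λ 2^e≤ →
    ℕ.<-irrefl refl (begin-strict
      2 ^ (e * 4)                    ≡⟨ ℕ.^-*-assoc 2 e 4 ⟨
      (2 ^ e) ^ 4                    ≤⟨ ℕ.^-monoˡ-≤ 4 2^e≤ ⟩
      (d * n ^ r) ^ 4              ≡⟨ *-^ d (n ^ r) 4 ⟩
      d ^ 4 * (n ^ r) ^ 4
        ≡⟨ cong (d ^ 4 *_) (trans (ℕ.^-*-assoc n r 4)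
             (trans (cong (n ^_) (ℕ.*-comm r 4)) (sym (ℕ.^-*-assoc n 4 r)))) ⟩
      d ^ 4 * (n ^ 4) ^ r        ≤⟨ ℕ.*-monoʳ-≤ (d ^ 4) (ℕ.^-monoˡ-≤ r n⁴≤2^l) ⟩
      d ^ 4 * (2 ^ l) ^ r        ≡⟨ cong (d ^ 4 *_) (ℕ.^-*-assoc 2 l r) ⟩
      d ^ 4 * 2 ^ (l * r)
        -- Bounding the factor `d` by `2 ^ d` makes the chain strict.
        <⟨ ℕ.*-monoˡ-< (2 ^ (l * r)) {{ℕ.m^n≢0 2 (l * r)}} (ℕ.^-monoˡ-< 4 (n<2^n d)) ⟩
      (2 ^ d) ^ 4 * 2 ^ (l * r)
        ≡⟨ cong (_* 2 ^ (l * r)) (ℕ.^-*-assoc 2 d 4) ⟩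
      2 ^ (d * 4) * 2 ^ (l * r)
        ≡⟨ ℕ.^-distribˡ-+-* 2 (d * 4) (l * r) ⟨
      2 ^ (d * 4 + l * r)
        ≤⟨ ℕ.^-monoʳ-≤ 2 (ℕ.≤-trans (ℕ.+-monoˡ-≤ (l * r) (ℕ.*-monoˡ-≤ 4 d≤s)) (exponents b≤1)) ⟩
      2 ^ (e * 4)                    ∎)
    where
    open ℕ.≤-Reasoning
    l = b + (s + s)
    r = suc s + suc (b + s)
    e = suc s * suc (b + s)

    exponents : ∀ {b} → b ≤ 1 →
      s * 4 + (b + (s + s)) * (suc s + suc (b + s)) ≤ (suc s * suc (b + s)) * 4
    -- The two sides differ by exactly 4 for `b = 0` and by 5 for `b = 1`.
    exponents z≤n = ℕ.≤-trans (ℕ.m≤m+n _ 4) (ℕ.≤-reflexive (lemma s))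
      where
      lemma : ∀ s → s * 4 + (s + s) * ((1 + s) + (1 + s)) + 4
                  ≡ ((1 + s) * (1 + s)) * 4
      lemma = solve-∀
    exponents (s≤s z≤n) = ℕ.≤-trans (ℕ.m≤m+n _ 5) (ℕ.≤-reflexive (lemma s))
      where
      lemma : ∀ s → s * 4 + (1 + (s + s)) * ((1 + s) + (2 + s)) + 5
                  ≡ ((1 + s) * (2 + s)) * 4
      lemma = solve-∀

  -- From 2^(4x) ≤ n⁴ ≤ 2^(b+2s) follows 4x ≤ 2s + 1, which is impossible for s < x. Thus a
  -- threshold on `n` becomes a lower bound on `s`.
  half-large : ∀ n x b s → b ≤ 1 → 2 ^ x ≤ n → n ^ 4 ≤ 2 ^ (b + (s + s)) → x ≤ s
  half-large n x b s b≤1 2^x≤n n⁴≤ = ℕ.≮⇒≥ λ s<x → ℕ.<-irrefl refl (begin-strict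
    x * 4                  ≤⟨ 2^-cancel-≤ (begin
                                  2 ^ (x * 4)     ≡⟨ ℕ.^-*-assoc 2 x 4 ⟨
                                  (2 ^ x) ^ 4     ≤⟨ ℕ.^-monoˡ-≤ 4 2^x≤n ⟩
                                  n ^ 4             ≤⟨ n⁴≤ ⟩
                                  2 ^ (b + (s + s)) ∎) ⟩
    b + (s + s)          ≤⟨ ℕ.+-monoˡ-≤ (s + s) b≤1 ⟩
    suc s + s              <⟨ ℕ.+-mono-≤-< s<x s<x ⟩
    x + x                  ≤⟨ ℕ.m≤m+n (x + x) (x + x) ⟩
    x + x + (x + x)    ≡⟨ lemma x ⟩
    x * 4                  ∎)
    where
    open ℕ.≤-Reasoning
    lemma : ∀ x → x + x + (x + x) ≡ x * 4
    lemma = solve-∀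

-- Expectations over outcomes and the union bound.

module BicliqueProbability where

  open CommutativeRing ℚ.+-*-commutativeRing using (semiring)
  open import Algebra.Properties.Semiring.Exp semiring using (_^_; ^-homo-*)
  open import Algebra.Properties.Semiring.Mult semiring
    using (×-assoc-*; ×-assocˡ) renaming (_×_ to _·_)
  open import Data.Bool.ListAction using (any)
  open import Data.Bool.Properties using (T-∧)
  open import Data.Integer.Base using (+_; -[1+_])
  open import Data.Integer.Tactic.RingSolver using (solve-∀)
  open import Data.List.Base using (List; []; _∷_; _++_; length; map; cartesianProduct)
  open import Data.List.Membership.Propositional using (lose) renaming (_∈_ to _∈ˡ_)
  open import Data.List.Membership.Propositional.Properties
    using (∈-map⁺; ∈-map⁻; ∈-++⁺ˡ; ∈-++⁺ʳ; ∈-++⁻; ∈-cartesianProduct⁺; ∈-cartesianProduct⁻)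
  open import Data.List.Properties using (length-map; length-++)
  open import Data.List.Relation.Unary.Any using (here; there)
  open import Data.List.Relation.Unary.Any.Properties using (any⁺)
  open import Data.Rational.Base
    using (ℚ; 0ℚ; 1ℚ; ½; _+_; _*_; _-_; _≤_; _<_; nonNegative; *<*; toℚᵘ)
  open import Data.Rational.Solver using (module +-*-Solver)
  import Data.Rational.Unnormalised.Base as ℚᵘ
  import Data.Rational.Unnormalised.Properties as ℚᵘ
  open import Function.Bundles using (Equivalence)
  open ExponentBounds using (biclique-count)

  𝟙 : Bool → ℚ
  𝟙 b = if b then 1ℚ else 0ℚ

  0≤1 : 0ℚ ≤ 1ℚ
  0≤1 = ℚ.nonNegative⁻¹ 1ℚ

  0≤𝟙 : ∀ b → 0ℚ ≤ 𝟙 b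
  0≤𝟙 true  = 0≤1
  0≤𝟙 false = ℚ.≤-refl

  module _ {p : ℚ} where

    𝔼-row-+ : (f g : Vec Bool n → ℚ) → 𝔼-row p (λ e → f e + g e) ≡ 𝔼-row p f + 𝔼-row p g
    𝔼-row-+ {zero}  f g = refl
    𝔼-row-+ {suc n} f g =
      trans (cong₂ (λ x y → p * x + (1ℚ - p) * y) (𝔼-row-+ (f ∘ (true ∷_)) (g ∘ (true ∷_)))
                                                   (𝔼-row-+ (f ∘ (false ∷_)) (g ∘ (false ∷_))))
            (lemma p (1ℚ - p) (𝔼-row p (f ∘ (true ∷_))) (𝔼-row p (g ∘ (true ∷_)))
                     (𝔼-row p (f ∘ (false ∷_))) (𝔼-row p (g ∘ (false ∷_))))
      where
      lemma : ∀ a b u v x y → a * (u + v) + b * (x + y) ≡ (a * u + b * x) + (a * v + b * y)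
      lemma = solve 6 (λ a b u v x y →
        a :* (u :+ v) :+ b :* (x :+ y) := (a :* u :+ b :* x) :+ (a :* v :+ b :* y)) refl
        where open +-*-Solver

    𝔼-row-const : ∀ n c → 𝔼-row {n} p (λ _ → c) ≡ c
    𝔼-row-const zero    c = refl
    𝔼-row-const (suc n) c = trans (cong (λ x → p * x + (1ℚ - p) * x) (𝔼-row-const n c)) (lemma p c)
      where
      lemma : ∀ a x → a * x + (1ℚ - a) * x ≡ x
      lemma = solve 2 (λ a x → a :* x :+ (con 1ℚ :- a) :* x := x) refl
        where open +-*-Solver

    𝔼-row-cong : {f g : Vec Bool n → ℚ} → (∀ e → f e ≡ g e) → 𝔼-row p f ≡ 𝔼-row p g
    𝔼-row-cong {zero}  f≗g = f≗g []
    𝔼-row-cong {suc n} f≗g = cong₂ (λ x y → p * x + (1ℚ - p) * y)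
      (𝔼-row-cong (f≗g ∘ (true ∷_))) (𝔼-row-cong (f≗g ∘ (false ∷_)))

    𝔼-+ : (f g : Outcome n → ℚ) → 𝔼 p (λ ω → f ω + g ω) ≡ 𝔼 p f + 𝔼 p g
    𝔼-+ {zero}  f g = refl
    𝔼-+ {suc n} f g = trans (𝔼-row-cong λ e → 𝔼-+ (λ ω → f (e ∷ ω)) (λ ω → g (e ∷ ω)))
                            (𝔼-row-+ (λ e → 𝔼 p λ ω → f (e ∷ ω)) (λ e → 𝔼 p λ ω → g (e ∷ ω)))

    𝔼-const : ∀ n c → 𝔼 {n} p (λ _ → c) ≡ c
    𝔼-const zero    c = refl
    𝔼-const (suc n) c = trans (𝔼-row-cong {n} (λ _ → 𝔼-const n c)) (𝔼-row-const n c)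

    𝔼-cong : {f g : Outcome n → ℚ} → (∀ ω → f ω ≡ g ω) → 𝔼 p f ≡ 𝔼 p g
    𝔼-cong {zero}  f≗g = f≗g []
    𝔼-cong {suc n} f≗g = 𝔼-row-cong λ e → 𝔼-cong λ ω → f≗g (e ∷ ω)

    Pr-not : (B : Outcome n → Bool) → Pr p (not ∘ B) ≡ 1ℚ - Pr p B
    Pr-not {n} B = begin
      Pr p (not ∘ B)                         ≡⟨ lemma (Pr p (not ∘ B)) (Pr p B) ⟩
      (Pr p (not ∘ B) + Pr p B) - Pr p B     ≡⟨ cong (_- Pr p B) (𝔼-+ (𝟙 ∘ not ∘ B) (𝟙 ∘ B)) ⟨
      𝔼 p (λ ω → 𝟙 (not (B ω)) + 𝟙 (B ω)) - Pr p B
        ≡⟨ cong (_- Pr p B) (trans (𝔼-cong (complement ∘ B)) (𝔼-const n 1ℚ)) ⟩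
      1ℚ - Pr p B                            ∎
      where
      open ≡-Reasoning
      lemma : ∀ x y → x ≡ (x + y) - y
      lemma = solve 2 (λ x y → x := (x :+ y) :- y) refl
        where open +-*-Solver
      complement : ∀ b → 𝟙 (not b) + 𝟙 b ≡ 1ℚ
      complement true  = refl
      complement false = refl

  𝔼-row-mono : {f g : Vec Bool n → ℚ} → (∀ e → f e ≤ g e) → 𝔼-row ½ f ≤ 𝔼-row ½ g
  𝔼-row-mono {zero}  f≤g = f≤g []
  𝔼-row-mono {suc n} f≤g = ℚ.+-mono-≤
    (ℚ.*-monoˡ-≤-nonNeg ½ (𝔼-row-mono (f≤g ∘ (true ∷_))))
    (ℚ.*-monoˡ-≤-nonNeg (1ℚ - ½) (𝔼-row-mono (f≤g ∘ (false ∷_))))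

  𝔼-mono : {f g : Outcome n → ℚ} → (∀ ω → f ω ≤ g ω) → 𝔼 ½ f ≤ 𝔼 ½ g
  𝔼-mono {zero}  f≤g = f≤g []
  𝔼-mono {suc n} f≤g = 𝔼-row-mono λ e → 𝔼-mono λ ω → f≤g (e ∷ ω)

  Pr-∨ : (A B : Outcome n → Bool) → Pr ½ (λ ω → A ω ∨ B ω) ≤ Pr ½ A + Pr ½ B
  Pr-∨ A B = ℚ.≤-trans (𝔼-mono λ ω → union (A ω) (B ω)) (ℚ.≤-reflexive (𝔼-+ (𝟙 ∘ A) (𝟙 ∘ B)))
    where
    union : ∀ a b → 𝟙 (a ∨ b) ≤ 𝟙 a + 𝟙 b
    union true  b = ℚ.≤-trans (ℚ.≤-reflexive (sym (ℚ.+-identityʳ 1ℚ))) (ℚ.+-monoʳ-≤ 1ℚ (0≤𝟙 b))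
    union false b = ℚ.≤-reflexive (sym (ℚ.+-identityˡ (𝟙 b)))

  Pr-any : ∀ {X : Set} (P : X → Outcome n → Bool) xs {c} → (∀ {x} → x ∈ˡ xs → Pr ½ (P x) ≤ c) →
           Pr ½ (λ ω → any (λ x → P x ω) xs) ≤ length xs · c
  Pr-any {n = n} P []       _  = ℚ.≤-reflexive (𝔼-const n 0ℚ)
  Pr-any P (x ∷ xs) ≤c = ℚ.≤-trans (Pr-∨ (P x) _)
                                   (ℚ.+-mono-≤ (≤c (here refl)) (Pr-any P xs (≤c ∘ there)))

  0≤½^ : ∀ k → 0ℚ ≤ ½ ^ k
  0≤½^ zero    = 0≤1
  0≤½^ (suc k) = ℚ.≤-trans (ℚ.≤-reflexive (sym (ℚ.*-zeroʳ ½))) (ℚ.*-monoˡ-≤-nonNeg ½ (0≤½^ k))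

  -- The probability that two given vertex sets form a biclique.

  allTrue : Vec Bool n → Subset n → Bool
  allTrue []      []          = true
  allTrue (x ∷ e) (true  ∷ σ) = x ∧ allTrue e σ
  allTrue (x ∷ e) (false ∷ σ) = allTrue e σ

  -- Each bit in `σ` contributes a factor ½ and the others average out. The constant `c` stands for
  -- the expectation over the later rows.
  𝔼-row-allTrue : ∀ (σ : Subset n) c →
                  𝔼-row ½ (λ e → if allTrue e σ then c else 0ℚ) ≡ ½ ^ ∣ σ ∣ * c
  𝔼-row-allTrue []          c = sym (ℚ.*-identityˡ c)
  𝔼-row-allTrue {suc n} (true  ∷ σ) c = begin
    ½ * 𝔼-row ½ (λ e → if allTrue e σ then c else 0ℚ) + (1ℚ - ½) * 𝔼-row {n} ½ (λ _ → 0ℚ)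
      ≡⟨ cong₂ (λ x y → ½ * x + (1ℚ - ½) * y) (𝔼-row-allTrue σ c) (𝔼-row-const n 0ℚ) ⟩
    ½ * (½ ^ ∣ σ ∣ * c) + 0ℚ
      ≡⟨ ℚ.+-identityʳ _ ⟩
    ½ * (½ ^ ∣ σ ∣ * c)
      ≡⟨ ℚ.*-assoc ½ (½ ^ ∣ σ ∣) c ⟨
    ½ * ½ ^ ∣ σ ∣ * c ∎
    where open ≡-Reasoning
  𝔼-row-allTrue (false ∷ σ) c =
    trans (cong (λ x → ½ * x + (1ℚ - ½) * x) (𝔼-row-allTrue σ c)) (lemma (½ ^ ∣ σ ∣ * c))
    where
    lemma : ∀ x → ½ * x + (1ℚ - ½) * x ≡ x
    lemma x = trans (sym (ℚ.*-distribʳ-+ x ½ (1ℚ - ½))) (ℚ.*-identityˡ x)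

  -- Follows the rows of the outcome, so that each condition concerns a fresh independent row. A
  -- vertex on both sides would need a loop, whence `false`.
  biclique : Outcome n → Subset n → Subset n → Bool
  biclique []      []          []          = true
  biclique (e ∷ ω) (true  ∷ σ) (true  ∷ ν) = false
  biclique (e ∷ ω) (true  ∷ σ) (false ∷ ν) = allTrue e ν ∧ biclique ω σ ν
  biclique (e ∷ ω) (false ∷ σ) (true  ∷ ν) = allTrue e σ ∧ biclique ω σ ν
  biclique (e ∷ ω) (false ∷ σ) (false ∷ ν) = biclique ω σ ν

  allTrue⁺ : ∀ (e : Vec Bool n) σ → (∀ {v} → v ∈ σ → T (lookup e v)) → T (allTrue e σ)
  allTrue⁺ []      []          _ = _
  allTrue⁺ (x ∷ e) (true  ∷ σ) h =
    Equivalence.from T-∧ (h Vec.here , allTrue⁺ e σ (h ∘ Vec.there))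
  allTrue⁺ (x ∷ e) (false ∷ σ) h = allTrue⁺ e σ (h ∘ Vec.there)

  biclique⁺ : ∀ (ω : Outcome n) σ ν → CommonNeighbors (graph ω) σ ν → T (biclique ω σ ν)
  biclique⁺ []      []          []          _  = _
  -- Vertex 0 would be its own neighbour: this instance of `cn` has type `T false`.
  biclique⁺ (e ∷ ω) (true  ∷ σ) (true  ∷ ν) cn = cn Vec.here Vec.here
  biclique⁺ (e ∷ ω) (true  ∷ σ) (false ∷ ν) cn = Equivalence.from T-∧
    (allTrue⁺ e ν (λ v∈ν → cn Vec.here (Vec.there v∈ν)) ,
     biclique⁺ ω σ ν (λ u∈σ v∈ν → cn (Vec.there u∈σ) (Vec.there v∈ν)))
  biclique⁺ (e ∷ ω) (false ∷ σ) (true  ∷ ν) cn = Equivalence.from T-∧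
    (allTrue⁺ e σ (λ u∈σ → cn (Vec.there u∈σ) Vec.here) ,
     biclique⁺ ω σ ν (λ u∈σ v∈ν → cn (Vec.there u∈σ) (Vec.there v∈ν)))
  biclique⁺ (e ∷ ω) (false ∷ σ) (false ∷ ν) cn =
    biclique⁺ ω σ ν (λ u∈σ v∈ν → cn (Vec.there u∈σ) (Vec.there v∈ν))

  -- Independence of the first row from the rest: once the row is fixed, the conjunction has
  -- probability `Pr ½ B` or 0.
  Pr-allTrue-∧ : ∀ (σ : Subset k) (B : Outcome n → Bool) →
                 𝔼-row ½ (λ e → Pr ½ (λ ω → allTrue e σ ∧ B ω)) ≡ ½ ^ ∣ σ ∣ * Pr ½ B
  Pr-allTrue-∧ {n = n} σ B = trans (𝔼-row-cong λ e → pull (allTrue e σ)) (𝔼-row-allTrue σ (Pr ½ B))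
    where
    pull : ∀ b → Pr ½ (λ ω → b ∧ B ω) ≡ (if b then Pr ½ B else 0ℚ)
    pull true  = refl
    pull false = 𝔼-const n 0ℚ

  ½^-step : ∀ j {k x} → x ≤ ½ ^ k → ½ ^ j * x ≤ ½ ^ (j ℕ.+ k)
  ½^-step j {k} x≤ = ℚ.≤-trans (ℚ.*-monoˡ-≤-nonNeg (½ ^ j) {{nonNegative (0≤½^ j)}} x≤)
                               (ℚ.≤-reflexive (sym (^-homo-* ½ j k)))

  -- Equality holds exactly when σ and ν are disjoint.
  Pr-biclique : ∀ (σ ν : Subset n) → Pr ½ (λ ω → biclique ω σ ν) ≤ ½ ^ (∣ σ ∣ ℕ.* ∣ ν ∣)
  Pr-biclique []          []          = ℚ.≤-refl
  Pr-biclique {suc n} (true ∷ σ) (true ∷ ν) =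
    ℚ.≤-trans (ℚ.≤-reflexive (𝔼-const (suc n) 0ℚ)) (0≤½^ (∣ true ∷ σ ∣ ℕ.* ∣ true ∷ ν ∣))
  Pr-biclique (true ∷ σ) (false ∷ ν) = ℚ.≤-trans
    (ℚ.≤-reflexive (Pr-allTrue-∧ ν (λ ω → biclique ω σ ν)))
    (½^-step ∣ ν ∣ (Pr-biclique σ ν))
  Pr-biclique (false ∷ σ) (true  ∷ ν) = ℚ.≤-trans
    (ℚ.≤-reflexive (Pr-allTrue-∧ σ (λ ω → biclique ω σ ν)))
    (subst (λ k → ½ ^ ∣ σ ∣ * Pr ½ (λ ω → biclique ω σ ν) ≤ ½ ^ k) (sym (ℕ.*-suc ∣ σ ∣ ∣ ν ∣))
           (½^-step ∣ σ ∣ (Pr-biclique σ ν)))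
  Pr-biclique {suc n} (false ∷ σ) (false ∷ ν) =
    ℚ.≤-trans (ℚ.≤-reflexive (𝔼-row-const n (Pr ½ (λ ω → biclique ω σ ν)))) (Pr-biclique σ ν)

  -- Enumeration of vertex sets and the union bound for bicliques.

  choose : ∀ n → ℕ → List (Subset n)
  choose zero    zero    = [] ∷ []
  choose zero    (suc k) = []
  choose (suc n) zero    = map (false ∷_) (choose n zero)
  choose (suc n) (suc k) = map (true ∷_) (choose n k) ++ map (false ∷_) (choose n (suc k))

  ∈-choose⁺ : ∀ (σ : Subset n) → σ ∈ˡ choose n ∣ σ ∣
  ∈-choose⁺ []          = here refl
  ∈-choose⁺ (true  ∷ σ) = ∈-++⁺ˡ (∈-map⁺ (true ∷_) (∈-choose⁺ σ))
  ∈-choose⁺ (false ∷ σ) = out ∣ σ ∣ (∈-choose⁺ σ)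
    where
    -- The size becomes a variable, since `choose` reduces only after a case split on it.
    out : ∀ {n} {σ : Subset n} k → σ ∈ˡ choose n k → (false ∷ σ) ∈ˡ choose (suc n) k
    out zero    σ∈ = ∈-map⁺ (false ∷_) σ∈
    out (suc k) σ∈ = ∈-++⁺ʳ _ (∈-map⁺ (false ∷_) σ∈)

  ∈-choose⁻ : ∀ n k {σ} → σ ∈ˡ choose n k → ∣ σ ∣ ≡ k
  ∈-choose⁻ zero    zero    (here refl) = refl
  ∈-choose⁻ (suc n) zero    σ∈ with ∈-map⁻ (false ∷_) σ∈
  ... | _ , τ∈ , refl = ∈-choose⁻ n zero τ∈
  ∈-choose⁻ (suc n) (suc k) σ∈ with ∈-++⁻ (map (true ∷_) (choose n k)) σ∈
  ... | inj₁ σ∈ˡ with ∈-map⁻ (true ∷_) σ∈ˡ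
  ...   | _ , τ∈ , refl = cong suc (∈-choose⁻ n k τ∈)
  ∈-choose⁻ (suc n) (suc k) σ∈ | inj₂ σ∈ʳ with ∈-map⁻ (false ∷_) σ∈ʳ
  ...   | _ , τ∈ , refl = ∈-choose⁻ n (suc k) τ∈

  -- By Pascal's rule and induction the count is at most n^k + n * n^k = (n + 1) * n^k, and n^k ≤ (n
  -- + 1)^k.
  length-choose : ∀ n k → length (choose n k) ℕ.≤ n ℕ.^ k
  length-choose zero    zero    = ℕ.≤-refl
  length-choose zero    (suc k) = z≤n
  length-choose (suc n) zero    =
    subst (ℕ._≤ 1) (sym (length-map (false ∷_) (choose n zero))) (length-choose n zero)
  length-choose (suc n) (suc k) = begin
    length (map (true ∷_) (choose n k) ++ map (false ∷_) (choose n (suc k)))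
      ≡⟨ length-++ (map (true ∷_) (choose n k)) ⟩
    length (map (true ∷_) (choose n k)) ℕ.+ length (map (false ∷_) (choose n (suc k)))
      ≡⟨ cong₂ ℕ._+_ (length-map _ (choose n k)) (length-map _ (choose n (suc k))) ⟩
    length (choose n k) ℕ.+ length (choose n (suc k))
      ≤⟨ ℕ.+-mono-≤ (length-choose n k) (length-choose n (suc k)) ⟩
    n ℕ.^ k ℕ.+ n ℕ.* n ℕ.^ k
      ≤⟨ ℕ.*-monoʳ-≤ (suc n) (ℕ.^-monoˡ-≤ k (ℕ.n≤1+n n)) ⟩
    suc n ℕ.* suc n ℕ.^ k ∎
    where open ℕ.≤-Reasoning

  length-cartesianProduct : ∀ {A B : Set} (xs : List A) (ys : List B) →
                            length (cartesianProduct xs ys) ≡ length xs ℕ.* length ys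
  length-cartesianProduct []       ys = refl
  length-cartesianProduct (x ∷ xs) ys = trans (length-++ (map (x ,_) ys))
    (cong₂ ℕ._+_ (length-map (x ,_) ys) (length-cartesianProduct xs ys))

  hasBiclique : ∀ a b → Outcome n → Bool
  hasBiclique {n} a b ω =
    any (λ (σ , ν) → biclique ω σ ν) (cartesianProduct (choose n a) (choose n b))

  hasBiclique⁺ : ∀ (ω : Outcome n) σ ν → CommonNeighbors (graph ω) σ ν →
                 T (hasBiclique ∣ σ ∣ ∣ ν ∣ ω)
  hasBiclique⁺ ω σ ν cn = any⁺ (λ (σ , ν) → biclique ω σ ν)
    (lose (∈-cartesianProduct⁺ (∈-choose⁺ σ) (∈-choose⁺ ν)) (biclique⁺ ω σ ν cn))

  -- Natural multiples of rationals and comparison with `δ`.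

  ·-monoʳ : ∀ k {x y} → x ≤ y → k · x ≤ k · y
  ·-monoʳ zero    x≤y = ℚ.≤-refl
  ·-monoʳ (suc k) x≤y = ℚ.+-mono-≤ x≤y (·-monoʳ k x≤y)

  0≤· : ∀ k {x} → 0ℚ ≤ x → 0ℚ ≤ k · x
  0≤· zero    0≤x = ℚ.≤-refl
  0≤· (suc k) 0≤x = ℚ.+-mono-≤ 0≤x (0≤· k 0≤x)

  ·-monoˡ : ∀ {j k x} → j ℕ.≤ k → 0ℚ ≤ x → j · x ≤ k · x
  ·-monoˡ {k = k} z≤n 0≤x = 0≤· k 0≤x
  ·-monoˡ {x = x} (s≤s j≤k) 0≤x = ℚ.+-monoʳ-≤ x (·-monoˡ j≤k 0≤x)

  Pr-hasBiclique : ∀ n a b → Pr {n} ½ (hasBiclique a b) ≤ (n ℕ.^ (a ℕ.+ b)) · ½ ^ (a ℕ.* b)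
  Pr-hasBiclique n a b = ℚ.≤-trans
    (Pr-any (λ (σ , ν) ω → biclique ω σ ν) (cartesianProduct (choose n a) (choose n b)) λ {(σ , ν)} ∈ →
      let σ∈ , ν∈ = ∈-cartesianProduct⁻ (choose n a) (choose n b) ∈
      in subst₂ (λ i j → Pr ½ (λ ω → biclique ω σ ν) ≤ ½ ^ (i ℕ.* j))
                (∈-choose⁻ n a σ∈) (∈-choose⁻ n b ν∈) (Pr-biclique σ ν))
    (·-monoˡ count (0≤½^ (a ℕ.* b)))
    where
    open ℕ.≤-Reasoning
    count : length (cartesianProduct (choose n a) (choose n b)) ℕ.≤ n ℕ.^ (a ℕ.+ b)
    count = begin
      length (cartesianProduct (choose n a) (choose n b))
        ≡⟨ length-cartesianProduct (choose n a) (choose n b) ⟩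
      length (choose n a) ℕ.* length (choose n b)
        ≤⟨ ℕ.*-mono-≤ (length-choose n a) (length-choose n b) ⟩
      n ℕ.^ a ℕ.* n ℕ.^ b
        ≡⟨ ℕ.^-distribˡ-+-* n a b ⟨
      n ℕ.^ (a ℕ.+ b) ∎

  0<½^ : ∀ k → 0ℚ < ½ ^ k
  0<½^ zero    = ℚ.positive⁻¹ 1ℚ
  0<½^ (suc k) = subst (_< ½ ^ suc k) (ℚ.*-zeroʳ ½) (ℚ.*-monoʳ-<-pos ½ (0<½^ k))

  2^·½^ : ∀ k → (2 ℕ.^ k) · ½ ^ k ≡ 1ℚ
  2^·½^ zero    = refl
  2^·½^ (suc k) = begin
    (2 ℕ.* 2 ℕ.^ k) · (½ * ½ ^ k)      ≡⟨ cong (_· (½ * ½ ^ k)) (ℕ.*-comm 2 (2 ℕ.^ k)) ⟩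
    (2 ℕ.^ k ℕ.* 2) · (½ * ½ ^ k)      ≡⟨ ×-assocˡ (½ * ½ ^ k) (2 ℕ.^ k) 2 ⟨
    (2 ℕ.^ k) · (2 · (½ * ½ ^ k))      ≡⟨ cong ((2 ℕ.^ k) ·_) (×-assoc-* 2 ½ (½ ^ k)) ⟨
    (2 ℕ.^ k) · (1ℚ * ½ ^ k)           ≡⟨ cong ((2 ℕ.^ k) ·_) (ℚ.*-identityˡ (½ ^ k)) ⟩
    (2 ℕ.^ k) · ½ ^ k                  ≡⟨ 2^·½^ k ⟩
    1ℚ                                 ∎
    where open ≡-Reasoning

  -- Gives the multiple as an explicit fraction over the denominator of `x`, free of normalisation
  -- by common divisors.
  toℚᵘ-homo-· : ∀ k x → toℚᵘ (k · x) ℚᵘ.≃ ℚᵘ.mkℚᵘ (+ k ℤ.* ℚ.↥ x) (ℚ.denominator-1 x)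
  toℚᵘ-homo-· zero    x = ℚᵘ.*≡* refl
  toℚᵘ-homo-· (suc k) x@(ℚ.mkℚ _ _ _) = ℚᵘ.≃-trans (ℚ.toℚᵘ-homo-+ x (k · x))
    (ℚᵘ.≃-trans (ℚᵘ.+-congʳ (toℚᵘ x) (toℚᵘ-homo-· k x))
      (ℚᵘ.*≡* (lemma (ℚ.↥ x) (ℚ.↧ x) (+ k))))
    where
    lemma : ∀ a d k → (a ℤ.* d ℤ.+ (k ℤ.* a) ℤ.* d) ℤ.* d ≡ ((ℤ.1ℤ ℤ.+ k) ℤ.* a) ℤ.* (d ℤ.* d)
    lemma = solve-∀

  archimedean : ∀ δ → 0ℚ < δ → ∃[ k ] 1ℚ ≤ k · δ
  archimedean (ℚ.mkℚ (+ zero)  _   _) (*<* (ℤ.+<+ ()))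
  archimedean (ℚ.mkℚ -[1+ _ ]  _   _) (*<* ())
  -- The denominator serves as multiplier: the product is the numerator, at least 1.
  archimedean δ@(ℚ.mkℚ (+ suc a) d-1 _) _ = suc d-1 , ℚ.toℚᵘ-cancel-≤
    (ℚᵘ.≤-respʳ-≃ (ℚᵘ.≃-sym (toℚᵘ-homo-· (suc d-1) δ)) (ℚᵘ.*≤* (begin
      + 1 ℤ.* + suc d-1                   ≡⟨ ℤ.*-identityˡ (+ suc d-1) ⟩
      + suc d-1                           ≤⟨ ℤ.+≤+ (ℕ.m≤m*n (suc d-1) (suc a)) ⟩
      + (suc d-1 ℕ.* suc a)               ≡⟨ ℤ.pos-* (suc d-1) (suc a) ⟩
      + suc d-1 ℤ.* + suc a               ≡⟨ ℤ.*-identityʳ (+ suc d-1 ℤ.* + suc a) ⟨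
      + suc d-1 ℤ.* + suc a ℤ.* + 1       ∎)))
    where open ℤ.≤-Reasoning

  -- Here `k` bounds 1/δ. Were δ ≤ j ½^e, then 1 ≤ kj ½^e < (kj + 1) ½^e ≤ 2^e ½^e = 1.
  ·½^<δ : ∀ {k j e δ} → 1ℚ ≤ k · δ → k ℕ.* j ℕ.< 2 ℕ.^ e → j · ½ ^ e < δ
  ·½^<δ {k} {j} {e} {δ} 1≤kδ kj<2^e = ℚ.≰⇒> λ δ≤ → ℚ.<-irrefl refl (begin-strict
    1ℚ                            ≤⟨ 1≤kδ ⟩
    k · δ                         ≤⟨ ·-monoʳ k δ≤ ⟩
    k · (j · ½ ^ e)               ≡⟨ ×-assocˡ (½ ^ e) k j ⟩
    (k ℕ.* j) · ½ ^ e             ≡⟨ ℚ.+-identityˡ _ ⟨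
    0ℚ + (k ℕ.* j) · ½ ^ e        <⟨ ℚ.+-monoˡ-< ((k ℕ.* j) · ½ ^ e) (0<½^ e) ⟩
    suc (k ℕ.* j) · ½ ^ e         ≤⟨ ·-monoˡ kj<2^e (0≤½^ e) ⟩
    (2 ℕ.^ e) · ½ ^ e             ≡⟨ 2^·½^ e ⟩
    1ℚ                            ∎)
    where open ℚ.≤-Reasoning

  Pr-noBiclique : ∀ n d {δ} → 1ℚ ≤ d · δ → ∀ b s → b ℕ.≤ 1 → d ℕ.≤ s →
    n ℕ.^ 4 ℕ.≤ 2 ℕ.^ (b ℕ.+ (s ℕ.+ s)) →
    1ℚ - δ < Pr {n} ½ (not ∘ hasBiclique (suc s) (suc (b ℕ.+ s)))
  Pr-noBiclique n d {δ} 1≤dδ b s b≤1 d≤s n⁴≤2^l = begin-strict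
    1ℚ - δ
      <⟨ ℚ.+-monoʳ-< 1ℚ (ℚ.neg-antimono-< few) ⟩
    1ℚ - Pr {n} ½ (hasBiclique a₁ a₂)
      ≡⟨ Pr-not {p = ½} {n} (hasBiclique a₁ a₂) ⟨
    Pr {n} ½ (not ∘ hasBiclique a₁ a₂) ∎
    where
    open ℚ.≤-Reasoning
    a₁ = suc s
    a₂ = suc (b ℕ.+ s)
    few : Pr {n} ½ (hasBiclique a₁ a₂) < δ
    few = ℚ.≤-<-trans (Pr-hasBiclique n a₁ a₂)
      (·½^<δ {d} {n ℕ.^ (a₁ ℕ.+ a₂)} {a₁ ℕ.* a₂} {δ} 1≤dδ (biclique-count n d b s b≤1 d≤s n⁴≤2^l))

-- The growth condition, the degree and the choice of threshold.

open import Data.Integer.Base using (ℤ; +_; -[1+_]; _+_; _-_; 1ℤ)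
open import Data.Integer.Tactic.RingSolver using (solve-∀)
open import Data.Rational.Base using (½; _/_)

open Acyclicity
open BicliqueProbability
open ExponentBounds using (half; half-large)

T-not : ∀ {b} → T (not b) → ¬ T b
T-not {false} _ ()

4·log₂≤⇒^4≤2^ : ∀ n l → (+ 4) ·log₂ suc n ≤ᶻ (+ 1 ℤ.* l) →
            ∃[ l′ ] l ≡ + l′ × suc n ℕ.^ 4 ℕ.≤ 2 ℕ.^ l′
4·log₂≤⇒^4≤2^ n (+ l) h = l , refl , (begin
  suc n ℕ.^ 4                          ≡⟨ ℕ.*-identityʳ (suc n ℕ.^ 4) ⟨
  suc n ℕ.^ 4 ℕ.* 1                    ≡⟨ cong (λ x → suc n ℕ.^ 4 ℕ.* 2 ℕ.^ x) (neg-part l) ⟨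
  suc n ℕ.^ 4 ℕ.* 2 ℕ.^ ((+ l) ⁻)      ≤⟨ subst (λ x → (+ 4) ·log₂ suc n ≤ᶻ x) (ℤ.*-identityˡ (+ l)) h ⟩
  2 ℕ.^ l ℕ.* 1                        ≡⟨ ℕ.*-identityʳ (2 ℕ.^ l) ⟩
  2 ℕ.^ l                              ∎)
  where
  open ℕ.≤-Reasoning
  neg-part : ∀ l → (+ l) ⁻ ≡ 0
  neg-part zero    = refl
  neg-part (suc l) = refl
-- For a negative exponent the hypothesis reads (n+1)⁴ * 2^(l+1) ≤ 1, but the left side is at least
-- 2.
4·log₂≤⇒^4≤2^ n -[1+ l ] h = contradiction
  (subst (λ x → (+ 4) ·log₂ suc n ≤ᶻ x) (ℤ.*-identityˡ -[1+ l ]) h)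
  (ℕ.<⇒≱ (ℕ.*-mono-≤ (ℕ.m^n>0 (suc n) 4) (ℕ.*-monoʳ-≤ 2 (ℕ.m^n>0 2 l))))

-- With l = b + 2s, a simplex of dimension l - m + 1 has l - m + 2 = (b + s + 1 - m) + s + 1
-- vertices; `m≤` makes the truncated subtraction exact.
suc-degree : ∀ b s m → m ℕ.≤ suc (b ℕ.+ s) →
  + suc (suc (b ℕ.+ s) ℕ.∸ m ℕ.+ s) ≡ ℤ.suc (+ (b ℕ.+ (s ℕ.+ s)) - + m + 1ℤ)
suc-degree b s m m≤ = cong ℤ.suc (begin
  + (j ℕ.+ s)
    ≡⟨ lemma (+ j) (+ s) (+ m) ⟩
  (+ j + + m) + + s - + m
    ≡⟨ cong (λ x → + x + + s - + m) (ℕ.m∸n+n≡m m≤) ⟩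
  (1ℤ + (+ b + + s)) + + s - + m
    ≡⟨ lemma′ (+ b) (+ s) (+ m) ⟩
  (+ b + (+ s + + s)) - + m + 1ℤ ∎)
  where
  open ≡-Reasoning
  j = suc (b ℕ.+ s) ℕ.∸ m
  lemma : ∀ j s m → j + s ≡ (j + m) + s - m
  lemma = solve-∀
  lemma′ : ∀ b s m → (1ℤ + (b + s)) + s - m ≡ (b + (s + s)) - m + 1ℤ
  lemma′ = solve-∀

proposition2 : (m : ℕ) → .{{_ : NonZero m}} →
    (ε : ℝ) → Positive ε →
    (l : ℕ → ℤ) →
    (∀ n → .{{_ : NonZero n}} → ((+ 4 / 1) +ᴿ ε) ·log₂ n ≤ l n) →
    AAS ½ (λ {n} G → IsTrivial (H̃ (l n - + m + 1ℤ) (multineighborComplex m G)))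
proposition2 m ε ε>0 l l≥ δ δ>0 with archimedean δ δ>0
-- This threshold forces d + m ≤ s: then `d`, a bound for 1/δ, is absorbed by the biclique estimate,
-- and m ≤ s + 1 + b.
... | d , 1≤dδ = 2 ℕ.^ (d ℕ.+ m) , λ where
    zero    N≤0 → contradiction N≤0 (ℕ.<⇒≱ (ℕ.m^n>0 2 (d ℕ.+ m)))
    (suc n) N≤n → probable n N≤n
  where
  probable : ∀ n → 2 ℕ.^ (d ℕ.+ m) ℕ.≤ suc n →
    Pr[G⟨n, ½ ⟩∈ (λ G → IsTrivial (H̃ (l (suc n) - + m + 1ℤ) (multineighborComplex m G))) ]>
      (ℚ.1ℚ ℚ.- δ)
  -- The rational 4 lies in the lower cut of 4 + ε: this unfolds to 4 - 4 lying in that of ε, and 4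
  -- - 4 computes to 0.
  probable n N≤n with l (suc n) | 4·log₂≤⇒^4≤2^ n (l (suc n)) (l≥ (suc n) (+ 4 / 1) ε>0)
  ... | _ | l′ , refl , n⁴≤2^l with half l′
  ... | b , s , b≤1 , refl = (not ∘ hasBiclique a₁ a₂) , vanishes ,
    Pr-noBiclique (suc n) d 1≤dδ b s b≤1 (ℕ.m+n≤o⇒m≤o d d+m≤s) n⁴≤2^l
    where
    a₁ = suc s
    a₂ = suc (b ℕ.+ s)

    d+m≤s : d ℕ.+ m ℕ.≤ s
    d+m≤s = half-large (suc n) (d ℕ.+ m) b s b≤1 N≤n n⁴≤2^l

    m≤a₂ : m ℕ.≤ a₂
    m≤a₂ = begin
      m              ≤⟨ ℕ.m≤n+m m d ⟩
      d ℕ.+ m        ≤⟨ d+m≤s ⟩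
      s              ≤⟨ ℕ.m≤n+m s (suc b) ⟩
      a₂             ∎
      where open ℕ.≤-Reasoning

    vanishes : ∀ ω → T (not (hasBiclique a₁ a₂ ω)) →
      IsTrivial (H̃ (+ (b ℕ.+ (s ℕ.+ s)) - + m + 1ℤ) (multineighborComplex m (graph ω)))
    -- A flag loses `a₂ ∸ m` vertices and ends at `a₁` vertices.
    vanishes ω none = homology-vanishes m (a₂ ℕ.∸ m) _ few
      (ℕ.≤-reflexive (sym (ℕ.m∸n+n≡m m≤a₂))) (suc-degree b s m m≤a₂)
      where
      -- The graph has `suc n` vertices, so `zero` is available as default apex.
      open MultineighborHomology (graph ω) zero

      few : ∀ τ → ∣ τ ∣ ≡ a₁ → ∣ common τ ∣ ℕ.< a₂
      -- Cutting `common τ` down to exactly `a₂` vertices gives a biclique of the excluded sizes.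
      few τ ∣τ∣≡ = ℕ.≰⇒> λ a₂≤ →
        let ν , ν⊆ , ∣ν∣≡ = ⊆-of-size (common τ) a₂≤
        in T-not none (subst₂ (λ i j → T (hasBiclique i j ω)) ∣τ∣≡ ∣ν∣≡
             (hasBiclique⁺ ω τ ν λ u∈τ v∈ν → ∈-common⁻ τ (ν⊆ v∈ν) _ u∈τ))
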